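{- Let $N\geq 2$ be an integer and for each $n\geq 0$ let $S_n\subseteq\{0,1,\dots,N-1\}^n$. If \[ \limsup_{n\to\infty}\frac{\log_N(|S_n|)}{n}=1, \] then $\limsup_{n\to\infty} M(S_n)=\infty$. Moreover, this is optimal in the following sense: for every $\epsilon>0$ there is a family of subsets $S_n\subseteq\{0,1,\dots,N-1\}^n$ such that $\{M(S_n)\}_n$ is uniformly bounded and $\frac{\log_N(|S_n|)}{n}>1-\epsilon$ for every $n$.
   Context: For a finite set $S\subseteq\mathbb{Z}^n$, $M(S):=M(\mathrm{Conv}(S))$, where $\mathrm{Conv}(S)\subseteq\mathbb{R}^n$ is the convex hull and, for an integral convex polytope $P\subseteq\mathbb{R}^n$, $M(P)$ is the largest integer $m$ such that there is a unimodular affine transformation $A$ (an affine map $x\mapsto Bx+z$ with $B$ an injective integer $n\times m$ matrix and $z\in\mathbb{Z}^n$) with $A([0,1]^m)\subseteq P$. -}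

module Defs where

open import Data.Nat as ℕ using (ℕ; zero; suc)
open import Data.Integer as ℤ using (ℤ)
open import Data.Rational as ℚ using (ℚ; 0ℚ; 1ℚ)
open import Data.Fin using (Fin; toℕ)
open import Data.Vec using (Vec)
import Data.Vec as Vec
open import Data.List using (List; length)
import Data.List as List
open import Data.Product using (Σ; _×_)
open import Relation.Binary.PropositionalEquality using (_≡_)

sumℚ : (k : ℕ) → (Fin k → ℚ) → ℚ
sumℚ zero    f = 0ℚ
sumℚ (suc k) f = f Data.Fin.zero ℚ.+ sumℚ k (λ i → f (Data.Fin.suc i))

sumℤ : (k : ℕ) → (Fin k → ℤ) → ℤ
sumℤ zero    f = ℤ.+ 0
sumℤ (suc k) f = f Data.Fin.zero ℤ.+ sumℤ k (λ i → f (Data.Fin.suc i))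

Point : ℕ → Set
Point n = Fin n → ℚ

embed : ∀ {N n} → Vec (Fin N) n → Point n
embed v i = (ℤ.+ toℕ (Vec.lookup v i)) ℚ./ 1

InConv : ∀ {N n} → List (Vec (Fin N) n) → Point n → Set
InConv {n = n} S p =
  Σ (Fin (length S) → ℚ) λ w →
    ((k : Fin (length S)) → 0ℚ ℚ.≤ w k) ×
    (sumℚ (length S) w ≡ 1ℚ) ×
    ((i : Fin n) → p i ≡ sumℚ (length S) (λ k → w k ℚ.* embed (List.lookup S k) i))

Matrix : ℕ → ℕ → Set
Matrix n m = Fin n → Fin m → ℤ

InjectiveMatrix : ∀ {n m} → Matrix n m → Set
InjectiveMatrix {n} {m} B =
  (x y : Fin m → ℤ) →
  ((i : Fin n) → sumℤ m (λ j → B i j ℤ.* x j) ≡ sumℤ m (λ j → B i j ℤ.* y j)) →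
  (j : Fin m) → x j ≡ y j

applyAffine : ∀ {n m} → Matrix n m → (Fin n → ℤ) → Point m → Point n
applyAffine {n} {m} B z x i =
  (z i ℚ./ 1) ℚ.+ sumℚ m (λ j → (B i j ℚ./ 1) ℚ.* x j)

InUnitCube : ∀ {m} → Point m → Set
InUnitCube {m} x = (j : Fin m) → (0ℚ ℚ.≤ x j) × (x j ℚ.≤ 1ℚ)

-- There is a unimodular affine map A with A([0,1]^m) ⊆ Conv(S);
-- i.e. "M(S) ≥ m".
HasCube : ∀ {N n} → List (Vec (Fin N) n) → ℕ → Set
HasCube {n = n} S m =
  Σ (Matrix n m) λ B → Σ (Fin n → ℤ) λ z →
    InjectiveMatrix B ×
    ((x : Point m) → InUnitCube x → InConv S (applyAffine B z x))

-- |S|^q · N^(n·p) > N^(n·q), i.e. log_N(|S|)/n > 1 - p/q  (for n ≥ 1, p,q ≥ 1).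
DenseAt : (N : ℕ) (n : ℕ) → List (Vec (Fin N) n) → (p q : ℕ) → Set
DenseAt N n S p q = N ℕ.^ (n ℕ.* q) ℕ.< (length S ℕ.^ q) ℕ.* (N ℕ.^ (n ℕ.* p))

{-# OPTIONS --safe #-}
-- Large S: split off a block of a coordinates. If S has density above N^(-a), then by pigeonhole some
-- two distinct prefixes u, u′ have a common set Y of suffixes that is again dense, and a cube in
-- Conv(Y) times the segment from u to u′ is a cube of one dimension more in Conv(S).
--
-- Optimality: choose a ∈ ℕⁿ greedily so that no nonzero b ∈ ℤⁿ with ‖b‖₁ ≤ s satisfies ⟨a, b⟩ = 0;
-- entries of size about the number of lattice points of the ℓ¹-ball suffice, which is N^(δ n) with δ small
-- when s is a small multiple of n. Let S be a popular level set of x ↦ ⟨a, x⟩. The columns of the matrix B of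
-- a cube in Conv(S) are nonzero and orthogonal to a, so they have ℓ¹-norm above s, while the rows have
-- ℓ¹-norm at most N because Conv(S) lies in [0, N]ⁿ. Hence m (s + 1) ≤ n N, which bounds m.
module Submission where

open import Defs
open import Data.Nat
open import Data.Nat.Properties
open import Data.Nat.DivMod using (m≡m%n+[m/n]*n; m%n<n; m/n*n≤m; m*n/n≡m; /-monoˡ-≤)
import Data.Nat.Tactic.RingSolver as ℕSolver
open import Data.Integer as ℤ using (ℤ; +_; -[1+_]; +[1+_]; ∣_∣)
import Data.Integer.Properties as ℤ
import Data.Integer.Tactic.RingSolver as ℤSolver
open import Data.Rational as ℚ using (ℚ; 0ℚ; 1ℚ)
import Data.Rational.Properties as ℚ
import Data.Rational.Solver as ℚSolver
import Data.Rational.Unnormalised as ℚᵘ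
import Data.Rational.Unnormalised.Properties as ℚᵘ
open import Data.Fin as Fin using (Fin; zero; suc; toℕ; _↑ˡ_; _↑ʳ_; splitAt; combine)
import Data.Fin.Properties as Fin
open import Data.Vec using (Vec)
import Data.Vec as Vec
import Data.Vec.Properties as Vec
open import Data.List using (List; []; _∷_; [_]; _++_; length; lookup; map; take; filter; concatMap; cartesianProductWith; cartesianProduct; allFin; upTo)
open import Data.List.Properties using (length-++; length-map; length-take; length-filter; length-tabulate; length-upTo)
open import Data.List.Membership.Propositional using (_∈_; find)
open import Data.List.Membership.Propositional.Properties
import Data.List.Membership.DecPropositional as DecMembership
open import Data.List.Relation.Unary.All as All using (All; []; _∷_)
open import Data.List.Relation.Unary.AllPairs using ([]; _∷_)
open import Data.List.Relation.Unary.Any as Any using (Any; here; there; index)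
open import Data.List.Relation.Unary.Any.Properties using (lookup-index)
open import Data.List.Relation.Unary.Unique.Propositional using (Unique)
open import Data.List.Relation.Unary.Unique.Propositional.Properties using (filter⁺; cartesianProductWith⁺; allFin⁺)
open import Data.Product using (Σ; ∃; ∃₂; _×_; _,_; proj₁; proj₂)
open import Data.Sum using (inj₁; inj₂; [_,_]′)
open import Function using (_∘_)
open import Relation.Nullary using (¬_; yes; no; Dec; ¬?; contradiction; _×-dec_)
open import Relation.Nullary.Decidable using (decidable-stable)
open import Relation.Binary.Definitions using (DecidableEquality)
open import Relation.Binary.PropositionalEquality hiding ([_])
open import Algebra.Bundles using (CommutativeRing)
import Algebra.Properties.Semiring.Sum as SemiringSum

-- Counting words

-- Passing to suffixes divides the set by about N^(2a), the number of ordered pairs of prefixes,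
-- while it shortens the words by `a` only. A density of N^(-a) thus drops to N^(-2a), and blocks of
-- one fixed length cannot be iterated. Doubling the block at each step restores the balance, at the
-- price of 2^(K+1) - 1 blocks' worth of coordinates for a cube of dimension K. Each K therefore
-- needs a single density threshold, 1 - 1/(2g) with g = 2^(K+1) - 1.
--
-- For optimality, the popular level loses a factor C, the number of levels, and density above 1 -
-- 1/Q requires C^Q < N^n. The ℓ¹-norm serves both sides: rows of `B` are bounded in it because the
-- signs of a row select two vertices of the cube, and a ball of radius n / D in it has at most
-- exponentially many points with a small rate. With T = 4Q, the T-th power of C is at most (2^n)^3:
-- one factor for the polynomial in n, two for the ball. The fourth factor 2^n gives the strict
-- inequality. Logarithms and roots are replaced throughout by powers of natural numbers.

module _ {A : Set} where

  -- Remove one occurrence of the head from `ys`; by uniqueness the tail of `xs` does not miss it.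
  unique-⊆⇒length-≤ : ∀ {xs ys : List A} → Unique xs → (∀ {x} → x ∈ xs → x ∈ ys) → length xs ≤ length ys
  unique-⊆⇒length-≤ {xs = []} _ _ = z≤n
  unique-⊆⇒length-≤ {xs = x ∷ xs} (x∉xs ∷ uniq) xs⊆ys
    with as , bs , refl ← ∈-∃++ (xs⊆ys (here refl)) = begin
    suc (length xs)               ≤⟨ s≤s (unique-⊆⇒length-≤ uniq avoid) ⟩
    suc (length (as ++ bs))       ≡⟨ cong suc (length-++ as) ⟩
    suc (length as + length bs)   ≡⟨ +-suc (length as) (length bs) ⟨
    length as + suc (length bs)   ≡⟨ length-++ as ⟨
    length (as ++ [ x ] ++ bs)    ∎
    where
    open ≤-Reasoning
    avoid : ∀ {y} → y ∈ xs → y ∈ as ++ bs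
    avoid y∈xs with ∈-++⁻ as (xs⊆ys (there y∈xs))
    ... | inj₁ y∈as         = ∈-++⁺ˡ y∈as
    ... | inj₂ (here refl)  = contradiction refl (All.lookup x∉xs y∈xs)
    ... | inj₂ (there y∈bs) = ∈-++⁺ʳ as y∈bs

  -- The factor `k` allows averaging without division: `popular-level` takes for it the number of
  -- levels.
  length-concatMap-≤ : ∀ {B : Set} (f : B → List A) k t (bs : List B) →
    (∀ {b} → b ∈ bs → k * length (f b) ≤ t) → k * length (concatMap f bs) ≤ length bs * t
  length-concatMap-≤ f k t [] _ = ≤-reflexive (*-zeroʳ k)
  length-concatMap-≤ f k t (b ∷ bs) bound = begin
    k * length (f b ++ concatMap f bs)               ≡⟨ cong (k *_) (length-++ (f b)) ⟩
    k * (length (f b) + length (concatMap f bs))     ≡⟨ *-distribˡ-+ k (length (f b)) _ ⟩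
    k * length (f b) + k * length (concatMap f bs)   ≤⟨ +-mono-≤ (bound (here refl)) (length-concatMap-≤ f k t bs (bound ∘ there)) ⟩
    t + length bs * t                                ∎
    where open ≤-Reasoning

length-cartesianProductWith : ∀ {A B C : Set} (f : A → B → C) (xs : List A) (ys : List B) →
  length (cartesianProductWith f xs ys) ≡ length xs * length ys
length-cartesianProductWith f []       ys = refl
length-cartesianProductWith f (x ∷ xs) ys = trans (length-++ (map (f x) ys))
  (cong₂ _+_ (length-map (f x) ys) (length-cartesianProductWith f xs ys))

allVec : ∀ N n → List (Vec (Fin N) n)
allVec N zero    = [ Vec.[] ]
allVec N (suc n) = cartesianProductWith Vec._∷_ (allFin N) (allVec N n)

∈-allVec : ∀ {N n} (v : Vec (Fin N) n) → v ∈ allVec N n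
∈-allVec Vec.[]       = here refl
∈-allVec (i Vec.∷ v) = ∈-cartesianProductWith⁺ Vec._∷_ (∈-allFin i) (∈-allVec v)

length-allVec : ∀ N n → length (allVec N n) ≡ N ^ n
length-allVec N zero    = refl
length-allVec N (suc n) = trans (length-cartesianProductWith Vec._∷_ (allFin N) (allVec N n))
  (cong₂ _*_ (length-tabulate {n = N} (λ i → i)) (length-allVec N n))

allVec-unique : ∀ N n → Unique (allVec N n)
allVec-unique N zero    = [] ∷ []
allVec-unique N (suc n) = cartesianProductWith⁺ Vec._∷_ (λ { refl → refl , refl }) (allFin⁺ N) (allVec-unique N n)

_≟ᵛ_ : ∀ {N n} → DecidableEquality (Vec (Fin N) n)
_≟ᵛ_ = Vec.≡-dec Fin._≟_

module PopularPair {N : ℕ} (a b M : ℕ) (S : List (Vec (Fin N) (a + b))) (S-unique : Unique S) where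

  open DecMembership (_≟ᵛ_ {N} {a + b}) using (_∈?_)

  common : Vec (Fin N) a × Vec (Fin N) a → List (Vec (Fin N) b)
  common (u , u′) = filter (λ y → (u Vec.++ y ∈? S) ×-dec (u′ Vec.++ y ∈? S)) (allVec N b)

  distinct? : (p : Vec (Fin N) a × Vec (Fin N) a) → Dec (proj₁ p ≢ proj₂ p)
  distinct? (u , u′) = ¬? (u ≟ᵛ u′)

  pairs : List (Vec (Fin N) a × Vec (Fin N) a)
  pairs = filter distinct? (cartesianProduct (allVec N a) (allVec N a))

  fibre : Vec (Fin N) b → List (Vec (Fin N) a)
  fibre y = filter (λ u → u Vec.++ y ∈? S) (allVec N a)

  firsts : Vec (Fin N) b → List (Vec (Fin N) (a + b))
  firsts y = map (Vec._++ y) (take 1 (fibre y))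

  -- The pairs are ordered, and in `∈-cover` the first component is always the head of the fibre, so
  -- only the words over the second component have to be listed.
  seconds : Vec (Fin N) a × Vec (Fin N) a → List (Vec (Fin N) (a + b))
  seconds p = map (proj₂ p Vec.++_) (common p)

  cover : List (Vec (Fin N) (a + b))
  cover = concatMap firsts (allVec N b) ++ concatMap seconds pairs

  ∈-cover : ∀ {u y} → u Vec.++ y ∈ S → u Vec.++ y ∈ cover
  ∈-cover {u} {y} uy∈S with fibre y in eq | ∈-filter⁺ (λ u → u Vec.++ y ∈? S) (∈-allVec u) uy∈S
  ... | v ∷ vs | u∈fibre with v ≟ᵛ u
  ...   | yes refl = ∈-++⁺ˡ (∈-concatMap⁺ firsts (Any.map
      (λ { refl → subst (λ us → u Vec.++ y ∈ map (Vec._++ y) (take 1 us)) (sym eq) (here refl) }) (∈-allVec y)))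
  ...   | no v≢u = ∈-++⁺ʳ (concatMap firsts (allVec N b)) (∈-concatMap⁺ seconds (Any.map
      (λ { refl → ∈-map⁺ (u Vec.++_) (∈-filter⁺ _ (∈-allVec y) (vy∈S , uy∈S)) })
      (∈-filter⁺ distinct? (∈-cartesianProduct⁺ (∈-allVec v) (∈-allVec u)) v≢u)))
    where
    vy∈S : v Vec.++ y ∈ S
    vy∈S = proj₂ (∈-filter⁻ (λ u → u Vec.++ y ∈? S) {xs = allVec N a} (subst (v ∈_) (sym eq) (here refl)))

  S⊆cover : ∀ {s} → s ∈ S → s ∈ cover
  S⊆cover {s} s∈S with u , y , refl ← Vec.splitAt a s = ∈-cover {u} {y} s∈S

  length-firsts : length (concatMap firsts (allVec N b)) ≤ N ^ b
  length-firsts = begin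
    length (concatMap firsts (allVec N b))     ≡⟨ *-identityˡ _ ⟨
    1 * length (concatMap firsts (allVec N b)) ≤⟨ length-concatMap-≤ firsts 1 1 (allVec N b) (λ {y} _ → short y) ⟩
    length (allVec N b) * 1                    ≡⟨ *-identityʳ _ ⟩
    length (allVec N b)                        ≡⟨ length-allVec N b ⟩
    N ^ b                                      ∎
    where
    open ≤-Reasoning
    short : ∀ y → 1 * length (firsts y) ≤ 1
    short y = begin
      1 * length (firsts y)        ≡⟨ *-identityˡ _ ⟩
      length (firsts y)            ≡⟨ length-map (Vec._++ y) (take 1 (fibre y)) ⟩
      length (take 1 (fibre y))    ≡⟨ length-take 1 (fibre y) ⟩
      1 ⊓ length (fibre y)         ≤⟨ m⊓n≤m 1 _ ⟩
      1                            ∎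

  length-pairs : length pairs ≤ N ^ (a + a)
  length-pairs = begin
    length pairs                                               ≤⟨ length-filter distinct? (cartesianProduct (allVec N a) (allVec N a)) ⟩
    length (cartesianProduct (allVec N a) (allVec N a))        ≡⟨ length-cartesianProductWith _,_ (allVec N a) (allVec N a) ⟩
    length (allVec N a) * length (allVec N a)                  ≡⟨ cong₂ _*_ (length-allVec N a) (length-allVec N a) ⟩
    N ^ a * N ^ a                                              ≡⟨ ^-distribˡ-+-* N a a ⟨
    N ^ (a + a)                                                ∎
    where open ≤-Reasoning

  length-seconds : (∀ {p} → p ∈ pairs → length (common p) ≤ M) →
    length (concatMap seconds pairs) ≤ N ^ (a + a) * M
  length-seconds few = begin
    length (concatMap seconds pairs)      ≡⟨ *-identityˡ _ ⟨
    1 * length (concatMap seconds pairs)  ≤⟨ length-concatMap-≤ seconds 1 M pairs short ⟩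
    length pairs * M                      ≤⟨ *-monoˡ-≤ M length-pairs ⟩
    N ^ (a + a) * M                       ∎
    where
    open ≤-Reasoning
    short : ∀ {p} → p ∈ pairs → 1 * length (seconds p) ≤ M
    short {p} p∈ = begin
      1 * length (seconds p) ≡⟨ *-identityˡ _ ⟩
      length (seconds p)     ≡⟨ length-map (proj₂ p Vec.++_) (common p) ⟩
      length (common p)      ≤⟨ few p∈ ⟩
      M                      ∎

  few⇒small : (∀ {p} → p ∈ pairs → length (common p) ≤ M) → length S ≤ N ^ b + N ^ (a + a) * M
  few⇒small few = begin
    length S      ≤⟨ unique-⊆⇒length-≤ S-unique S⊆cover ⟩
    length cover  ≡⟨ length-++ (concatMap firsts (allVec N b)) ⟩
    _             ≤⟨ +-mono-≤ length-firsts (length-seconds few) ⟩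
    N ^ b + N ^ (a + a) * M ∎
    where open ≤-Reasoning

-- Every element of S is the first of its fibre over [N]^b or forms a pair with it,
-- so if every pair of prefixes had at most M common suffixes, S would be small.
popular-pair : ∀ {N} a b M (S : List (Vec (Fin N) (a + b))) → Unique S →
  N ^ b + N ^ (a + a) * M < length S →
  ∃₂ λ u u′ → u ≢ u′ × ∃ λ (Y : List (Vec (Fin N) b)) → Unique Y × M < length Y ×
    (∀ y → y ∈ Y → u Vec.++ y ∈ S × u′ Vec.++ y ∈ S)
popular-pair {N} a b M S S-unique large = conclude (Any.any? (λ p → M <? length (common p)) pairs)
  where
  open PopularPair a b M S S-unique
  conclude : Dec (Any (λ p → M < length (common p)) pairs) → _
  conclude (no ¬many) = contradiction
    (few⇒small (λ p∈ → ≮⇒≥ (λ many → ¬many (Any.map (λ { refl → many }) p∈)))) (<⇒≱ large)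
  conclude (yes many) with (u , u′) , p∈ , M< ← find many =
    u , u′ , proj₂ (∈-filter⁻ distinct? {xs = cartesianProduct (allVec N a) (allVec N a)} p∈) ,
    common (u , u′) , filter⁺ _ (allVec-unique N b) , M< , λ _ y∈ → proj₂ (∈-filter⁻ _ {xs = allVec N b} y∈)

-- Convex combinations

module ∑ℚ = SemiringSum (CommutativeRing.semiring ℚ.+-*-commutativeRing)
module ∑ℤ = SemiringSum ℤ.+-*-semiring
module ∑ℕ = SemiringSum +-*-semiring

sumℚ≡sum : ∀ k (f : Fin k → ℚ) → sumℚ k f ≡ ∑ℚ.sum f
sumℚ≡sum zero    f = refl
sumℚ≡sum (suc k) f = cong (f zero ℚ.+_) (sumℚ≡sum k (f ∘ suc))

sumℤ≡sum : ∀ k (f : Fin k → ℤ) → sumℤ k f ≡ ∑ℤ.sum f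
sumℤ≡sum zero    f = refl
sumℤ≡sum (suc k) f = cong (λ s → f zero ℤ.+ s) (sumℤ≡sum k (f ∘ suc))

sumℚ-cong : ∀ {k} {f g : Fin k → ℚ} → (∀ i → f i ≡ g i) → sumℚ k f ≡ sumℚ k g
sumℚ-cong {zero}  f≗g = refl
sumℚ-cong {suc k} f≗g = cong₂ ℚ._+_ (f≗g zero) (sumℚ-cong (f≗g ∘ suc))

sumℚ-distrib-+ : ∀ {k} (f g : Fin k → ℚ) → sumℚ k (λ i → f i ℚ.+ g i) ≡ sumℚ k f ℚ.+ sumℚ k g
sumℚ-distrib-+ {k} f g = trans (sumℚ≡sum k (λ i → f i ℚ.+ g i)) (trans (∑ℚ.∑-distrib-+ f g) (cong₂ ℚ._+_ (sym (sumℚ≡sum k f)) (sym (sumℚ≡sum k g))))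

sumℚ-*ˡ : ∀ {k} c (f : Fin k → ℚ) → sumℚ k (λ i → c ℚ.* f i) ≡ c ℚ.* sumℚ k f
sumℚ-*ˡ {k} c f = trans (sumℚ≡sum k (λ i → c ℚ.* f i)) (trans (sym (∑ℚ.*-distribˡ-sum c f)) (cong (c ℚ.*_) (sym (sumℚ≡sum _ f))))

sumℚ-*ʳ : ∀ {k} c (f : Fin k → ℚ) → sumℚ k (λ i → f i ℚ.* c) ≡ sumℚ k f ℚ.* c
sumℚ-*ʳ {k} c f = trans (sumℚ≡sum k (λ i → f i ℚ.* c)) (trans (sym (∑ℚ.*-distribʳ-sum c f)) (cong (ℚ._* c) (sym (sumℚ≡sum _ f))))

sumℚ-comm : ∀ {k l} (f : Fin k → Fin l → ℚ) →
  sumℚ k (λ i → sumℚ l (f i)) ≡ sumℚ l (λ j → sumℚ k (λ i → f i j))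
sumℚ-comm {k} {l} f = begin
  sumℚ k (λ i → sumℚ l (f i))                ≡⟨ sumℚ-cong (λ i → sumℚ≡sum l (f i)) ⟩
  sumℚ k (λ i → ∑ℚ.sum (f i))                ≡⟨ sumℚ≡sum k _ ⟩
  ∑ℚ.sum (λ i → ∑ℚ.sum (f i))                ≡⟨ ∑ℚ.∑-comm f ⟩
  ∑ℚ.sum (λ j → ∑ℚ.sum (λ i → f i j))        ≡⟨ sumℚ≡sum l _ ⟨
  sumℚ l (λ j → ∑ℚ.sum (λ i → f i j))        ≡⟨ sumℚ-cong {l} (λ j → sumℚ≡sum k (λ i → f i j)) ⟨
  sumℚ l (λ j → sumℚ k (λ i → f i j))        ∎
  where open ≡-Reasoning

sumℚ-zero : ∀ k → sumℚ k (λ _ → 0ℚ) ≡ 0ℚ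
sumℚ-zero zero    = refl
sumℚ-zero (suc k) = trans (ℚ.+-identityˡ _) (sumℚ-zero k)

sumℚ-mono : ∀ {k} {f g : Fin k → ℚ} → (∀ i → f i ℚ.≤ g i) → sumℚ k f ℚ.≤ sumℚ k g
sumℚ-mono {zero}  f≤g = ℚ.≤-refl
sumℚ-mono {suc k} f≤g = ℚ.+-mono-≤ (f≤g zero) (sumℚ-mono (f≤g ∘ suc))

sumℚ-nonNeg : ∀ {k} {f : Fin k → ℚ} → (∀ i → 0ℚ ℚ.≤ f i) → 0ℚ ℚ.≤ sumℚ k f
sumℚ-nonNeg {k} {f} 0≤f = subst (ℚ._≤ sumℚ k f) (sumℚ-zero k) (sumℚ-mono {k} 0≤f)

*-nonNeg : ∀ {p q} → 0ℚ ℚ.≤ p → 0ℚ ℚ.≤ q → 0ℚ ℚ.≤ p ℚ.* q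
*-nonNeg {p} {q} 0≤p 0≤q = ℚ.nonNegative⁻¹ (p ℚ.* q)
  {{ℚ.nonNeg*nonNeg⇒nonNeg p {{ℚ.nonNegative 0≤p}} q {{ℚ.nonNegative 0≤q}}}}

δ : ∀ {k} → Fin k → Fin k → ℚ
δ zero    zero    = 1ℚ
δ zero    (suc j) = 0ℚ
δ (suc i) zero    = 0ℚ
δ (suc i) (suc j) = δ i j

0≤1ℚ : 0ℚ ℚ.≤ 1ℚ
0≤1ℚ = ℚ.nonNegative⁻¹ 1ℚ

δ-nonNeg : ∀ {k} (i j : Fin k) → 0ℚ ℚ.≤ δ i j
δ-nonNeg zero    zero    = 0≤1ℚ
δ-nonNeg zero    (suc j) = ℚ.≤-refl
δ-nonNeg (suc i) zero    = ℚ.≤-refl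
δ-nonNeg (suc i) (suc j) = δ-nonNeg i j

sumℚ-δ : ∀ {k} (i : Fin k) (g : Fin k → ℚ) → sumℚ k (λ j → δ i j ℚ.* g j) ≡ g i
sumℚ-δ {suc k} zero g = begin
  1ℚ ℚ.* g zero ℚ.+ sumℚ k (λ j → 0ℚ ℚ.* g (suc j)) ≡⟨ cong₂ ℚ._+_ (ℚ.*-identityˡ (g zero)) (trans (sumℚ-*ˡ 0ℚ (g ∘ suc)) (ℚ.*-zeroˡ (sumℚ k (g ∘ suc)))) ⟩
  g zero ℚ.+ 0ℚ                                     ≡⟨ ℚ.+-identityʳ (g zero) ⟩
  g zero                                            ∎
  where open ≡-Reasoning
sumℚ-δ {suc k} (suc i) g = begin
  0ℚ ℚ.* g zero ℚ.+ sumℚ k (λ j → δ i j ℚ.* g (suc j)) ≡⟨ cong₂ ℚ._+_ (ℚ.*-zeroˡ (g zero)) (sumℚ-δ i (g ∘ suc)) ⟩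
  0ℚ ℚ.+ g (suc i)                                     ≡⟨ ℚ.+-identityˡ (g (suc i)) ⟩
  g (suc i)                                            ∎
  where open ≡-Reasoning

module _ {N n : ℕ} (S : List (Vec (Fin N) n)) where

  InConv-resp : ∀ {p p′ : Point n} → (∀ i → p i ≡ p′ i) → InConv S p → InConv S p′
  InConv-resp p≗p′ (w , w≥0 , ∑w , p≡) = w , w≥0 , ∑w , λ i → trans (sym (p≗p′ i)) (p≡ i)

  -- `InConv` wants one weight for each index of `S`. A family that may repeat or omit points is
  -- brought to this form by pushing its weights forward along `ρ`.
  InConv-family : ∀ k (ρ : Fin k → Fin (length S)) (w : Fin k → ℚ) → (∀ i → 0ℚ ℚ.≤ w i) → sumℚ k w ≡ 1ℚ →
    InConv S (λ i → sumℚ k (λ j → w j ℚ.* embed (lookup S (ρ j)) i))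
  InConv-family k ρ w w≥0 ∑w =
    W , (λ l → sumℚ-nonNeg (λ j → *-nonNeg (w≥0 j) (δ-nonNeg (ρ j) l))) ,
    (begin
      sumℚ (length S) W                        ≡⟨ sumℚ-cong (λ l → ℚ.*-identityʳ (W l)) ⟨
      sumℚ (length S) (λ l → W l ℚ.* 1ℚ)       ≡⟨ push (λ _ → 1ℚ) ⟩
      sumℚ k (λ j → w j ℚ.* 1ℚ)                ≡⟨ sumℚ-cong (λ j → ℚ.*-identityʳ (w j)) ⟩
      sumℚ k w                                 ≡⟨ ∑w ⟩
      1ℚ                                       ∎) ,
    λ i → sym (push (λ l → embed (lookup S l) i))
    where
    open ≡-Reasoning
    W : Fin (length S) → ℚ
    W l = sumℚ k (λ j → w j ℚ.* δ (ρ j) l)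
    push : ∀ g → sumℚ (length S) (λ l → W l ℚ.* g l) ≡ sumℚ k (λ j → w j ℚ.* g (ρ j))
    push g = begin
      sumℚ (length S) (λ l → W l ℚ.* g l)                                   ≡⟨ sumℚ-cong (λ l → sumℚ-*ʳ {k} (g l) _) ⟨
      sumℚ (length S) (λ l → sumℚ k (λ j → w j ℚ.* δ (ρ j) l ℚ.* g l))      ≡⟨ sumℚ-comm {length S} {k} _ ⟩
      sumℚ k (λ j → sumℚ (length S) (λ l → w j ℚ.* δ (ρ j) l ℚ.* g l))      ≡⟨ sumℚ-cong (λ j → sumℚ-cong (λ l → ℚ.*-assoc (w j) (δ (ρ j) l) (g l))) ⟩
      sumℚ k (λ j → sumℚ (length S) (λ l → w j ℚ.* (δ (ρ j) l ℚ.* g l)))    ≡⟨ sumℚ-cong (λ j → sumℚ-*ˡ (w j) (λ l → δ (ρ j) l ℚ.* g l)) ⟩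
      sumℚ k (λ j → w j ℚ.* sumℚ (length S) (λ l → δ (ρ j) l ℚ.* g l))      ≡⟨ sumℚ-cong (λ j → cong (w j ℚ.*_) (sumℚ-δ (ρ j) g)) ⟩
      sumℚ k (λ j → w j ℚ.* g (ρ j))                                        ∎

  InConv-convex : ∀ {p p′ : Point n} t → 0ℚ ℚ.≤ t → t ℚ.≤ 1ℚ → InConv S p → InConv S p′ →
    InConv S (λ i → (1ℚ ℚ.- t) ℚ.* p i ℚ.+ t ℚ.* p′ i)
  InConv-convex {p} {p′} t 0≤t t≤1 (w , w≥0 , ∑w , p≡) (w′ , w′≥0 , ∑w′ , p′≡) =
    (λ l → (1ℚ ℚ.- t) ℚ.* w l ℚ.+ t ℚ.* w′ l) ,
    (λ l → ℚ.+-mono-≤ (*-nonNeg 0≤1-t (w≥0 l)) (*-nonNeg 0≤t (w′≥0 l))) ,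
    (begin
      sumℚ L (λ l → (1ℚ ℚ.- t) ℚ.* w l ℚ.+ t ℚ.* w′ l) ≡⟨ ∑-mix w w′ ⟩
      (1ℚ ℚ.- t) ℚ.* sumℚ L w ℚ.+ t ℚ.* sumℚ L w′      ≡⟨ cong₂ (λ a b → (1ℚ ℚ.- t) ℚ.* a ℚ.+ t ℚ.* b) ∑w ∑w′ ⟩
      (1ℚ ℚ.- t) ℚ.* 1ℚ ℚ.+ t ℚ.* 1ℚ                   ≡⟨ solve 1 (λ t → (con 1ℚ :- t) :* con 1ℚ :+ t :* con 1ℚ := con 1ℚ) refl t ⟩
      1ℚ                                               ∎) ,
    λ i → begin
      (1ℚ ℚ.- t) ℚ.* p i ℚ.+ t ℚ.* p′ i ≡⟨ cong₂ (λ a b → (1ℚ ℚ.- t) ℚ.* a ℚ.+ t ℚ.* b) (p≡ i) (p′≡ i) ⟩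
      (1ℚ ℚ.- t) ℚ.* sumℚ L (λ l → w l ℚ.* e i l) ℚ.+ t ℚ.* sumℚ L (λ l → w′ l ℚ.* e i l) ≡⟨ ∑-mix _ _ ⟨
      sumℚ L (λ l → (1ℚ ℚ.- t) ℚ.* (w l ℚ.* e i l) ℚ.+ t ℚ.* (w′ l ℚ.* e i l)) ≡⟨ sumℚ-cong (λ l →
        solve 4 (λ t a b e → (con 1ℚ :- t) :* (a :* e) :+ t :* (b :* e) := ((con 1ℚ :- t) :* a :+ t :* b) :* e) refl t (w l) (w′ l) (e i l)) ⟩
      sumℚ L (λ l → ((1ℚ ℚ.- t) ℚ.* w l ℚ.+ t ℚ.* w′ l) ℚ.* e i l) ∎
    where
    open ≡-Reasoning
    open ℚSolver.+-*-Solver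
    L = length S
    e : Fin n → Fin L → ℚ
    e i l = embed (lookup S l) i
    0≤1-t : 0ℚ ℚ.≤ 1ℚ ℚ.- t
    0≤1-t = subst (ℚ._≤ 1ℚ ℚ.- t) (ℚ.+-inverseʳ t) (ℚ.+-monoˡ-≤ (ℚ.- t) t≤1)
    ∑-mix : ∀ f g → sumℚ L (λ l → (1ℚ ℚ.- t) ℚ.* f l ℚ.+ t ℚ.* g l) ≡ (1ℚ ℚ.- t) ℚ.* sumℚ L f ℚ.+ t ℚ.* sumℚ L g
    ∑-mix f g = trans (sumℚ-distrib-+ {L} _ _) (cong₂ ℚ._+_ (sumℚ-*ˡ (1ℚ ℚ.- t) f) (sumℚ-*ˡ t g))

-- Cubes over an edge

ι : ℤ → ℚ
ι i = i ℚ./ 1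

i+[j-i]≡j : ∀ i j → i ℤ.+ (j ℤ.- i) ≡ j
i+[j-i]≡j = ℤSolver.solve-∀

-- `ι i` is normalised by a gcd that does not compute for a variable `i`. The laws of `ι` are proved
-- on unnormalised fractions, where the denominator 1 is literal.
toℚᵘ-ι : ∀ i → ℚ.toℚᵘ (ι i) ℚᵘ.≃ ℚᵘ.mkℚᵘ i 0
toℚᵘ-ι i = ℚ.toℚᵘ-fromℚᵘ (ℚᵘ.mkℚᵘ i 0)

ι-injective : ∀ {i j} → ι i ≡ ι j → i ≡ j
ι-injective {i} {j} eq with ℚᵘ.*≡* e ← ℚ.fromℚᵘ-injective {ℚᵘ.mkℚᵘ i 0} {ℚᵘ.mkℚᵘ j 0} eq =
  trans (sym (ℤ.*-identityʳ i)) (trans e (ℤ.*-identityʳ j))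

ι-homo-+ : ∀ i j → ι (i ℤ.+ j) ≡ ι i ℚ.+ ι j
ι-homo-+ i j = ℚ.toℚᵘ-injective (begin-equality
  ℚ.toℚᵘ (ι (i ℤ.+ j))             ≃⟨ toℚᵘ-ι (i ℤ.+ j) ⟩
  ℚᵘ.mkℚᵘ (i ℤ.+ j) 0              ≃⟨ ℚᵘ.*≡* (cong (ℤ._* + 1) (cong₂ ℤ._+_ (sym (ℤ.*-identityʳ i)) (sym (ℤ.*-identityʳ j)))) ⟩
  ℚᵘ.mkℚᵘ i 0 ℚᵘ.+ ℚᵘ.mkℚᵘ j 0     ≃⟨ ℚᵘ.+-cong (toℚᵘ-ι i) (toℚᵘ-ι j) ⟨
  ℚ.toℚᵘ (ι i) ℚᵘ.+ ℚ.toℚᵘ (ι j)   ≃⟨ ℚ.toℚᵘ-homo-+ (ι i) (ι j) ⟨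
  ℚ.toℚᵘ (ι i ℚ.+ ι j)             ∎)
  where open ℚᵘ.≤-Reasoning

ι-homo-* : ∀ i j → ι (i ℤ.* j) ≡ ι i ℚ.* ι j
ι-homo-* i j = ℚ.toℚᵘ-injective (begin-equality
  ℚ.toℚᵘ (ι (i ℤ.* j))             ≃⟨ toℚᵘ-ι (i ℤ.* j) ⟩
  ℚᵘ.mkℚᵘ i 0 ℚᵘ.* ℚᵘ.mkℚᵘ j 0     ≃⟨ ℚᵘ.*-cong (toℚᵘ-ι i) (toℚᵘ-ι j) ⟨
  ℚ.toℚᵘ (ι i) ℚᵘ.* ℚ.toℚᵘ (ι j)   ≃⟨ ℚ.toℚᵘ-homo-* (ι i) (ι j) ⟨
  ℚ.toℚᵘ (ι i ℚ.* ι j)             ∎)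
  where open ℚᵘ.≤-Reasoning

ι-mono-≤ : ∀ {i j} → i ℤ.≤ j → ι i ℚ.≤ ι j
ι-mono-≤ {i} {j} i≤j = ℚ.toℚᵘ-cancel-≤ (begin
  ℚ.toℚᵘ (ι i)  ≃⟨ toℚᵘ-ι i ⟩
  ℚᵘ.mkℚᵘ i 0   ≤⟨ ℚᵘ.*≤* (ℤ.*-monoʳ-≤-nonNeg (+ 1) i≤j) ⟩
  ℚᵘ.mkℚᵘ j 0   ≃⟨ toℚᵘ-ι j ⟨
  ℚ.toℚᵘ (ι j)  ∎)
  where open ℚᵘ.≤-Reasoning

ι-cancel-≤ : ∀ {i j} → ι i ℚ.≤ ι j → i ℤ.≤ j
ι-cancel-≤ {i} {j} ιi≤ιj with ℚᵘ.*≤* e ← ℚᵘ.≤-respˡ-≃ (toℚᵘ-ι i) (ℚᵘ.≤-respʳ-≃ (toℚᵘ-ι j) (ℚ.toℚᵘ-mono-≤ ιi≤ιj)) =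
  subst₂ ℤ._≤_ (ℤ.*-identityʳ i) (ℤ.*-identityʳ j) e

ι-sum : ∀ k (f : Fin k → ℤ) → ι (sumℤ k f) ≡ sumℚ k (ι ∘ f)
ι-sum zero    f = refl
ι-sum (suc k) f = trans (ι-homo-+ (f zero) (sumℤ k (f ∘ suc))) (cong (ι (f zero) ℚ.+_) (ι-sum k (f ∘ suc)))

sumℚ-0* : ∀ k (f : Fin k → ℚ) → sumℚ k (λ i → 0ℚ ℚ.* f i) ≡ 0ℚ
sumℚ-0* k f = trans (sumℚ-*ˡ 0ℚ f) (ℚ.*-zeroˡ (sumℚ k f))

sumℤ-0* : ∀ k (f : Fin k → ℤ) → sumℤ k (λ i → + 0 ℤ.* f i) ≡ + 0
sumℤ-0* zero    f = refl
sumℤ-0* (suc k) f = trans (ℤ.+-identityˡ (sumℤ k _)) (sumℤ-0* k (f ∘ suc))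

↑-elim : ∀ {a b} {P : Fin (a + b) → Set} → (∀ i → P (i ↑ˡ b)) → (∀ i → P (a ↑ʳ i)) → ∀ i → P i
↑-elim {a} {b} {P} left right i with splitAt a i | Fin.join-splitAt a b i
... | inj₁ k | refl = left k
... | inj₂ k | refl = right k

differ-at : ∀ {N n} {u u′ : Vec (Fin N) n} → u ≢ u′ → ∃ λ i → Vec.lookup u i ≢ Vec.lookup u′ i
differ-at {n = n} {u} {u′} u≢u′ = Fin.¬∀⟶∃¬ n _ (λ i → Vec.lookup u i Fin.≟ Vec.lookup u′ i) λ same → u≢u′ (begin
  u                          ≡⟨ Vec.tabulate∘lookup u ⟨
  Vec.tabulate (Vec.lookup u)  ≡⟨ Vec.tabulate-cong same ⟩
  Vec.tabulate (Vec.lookup u′) ≡⟨ Vec.tabulate∘lookup u′ ⟩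
  u′                         ∎)
  where open ≡-Reasoning

module PrependEdge {N a b m : ℕ} (u u′ : Vec (Fin N) a) (u≢u′ : u ≢ u′)
  (B : Matrix b m) (z : Fin b → ℤ) where

  coord : Vec (Fin N) a → Fin a → ℤ
  coord v i = + toℕ (Vec.lookup v i)

  top : Fin a → Fin (suc m) → ℤ
  top i zero    = coord u′ i ℤ.- coord u i
  top i (suc j) = + 0

  bottom : Fin b → Fin (suc m) → ℤ
  bottom i zero    = + 0
  bottom i (suc j) = B i j

  B⁺ : Matrix (a + b) (suc m)
  B⁺ i = [ top , bottom ]′ (splitAt a i)

  z⁺ : Fin (a + b) → ℤ
  z⁺ i = [ coord u , z ]′ (splitAt a i)

  -- `B⁺` is block diagonal. A top row where `u` and `u′` differ recovers the first coordinate of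
  -- the argument, and the bottom rows recover the others through `B`.
  B⁺-injective : InjectiveMatrix B → InjectiveMatrix B⁺
  B⁺-injective B-inj x y same = λ { zero → head≡ ; (suc j) → B-inj (x ∘ suc) (y ∘ suc) tail≡ j }
    where
    open ≡-Reasoning
    d : ℤ
    d = top (proj₁ (differ-at u≢u′)) zero
    d≢0 : d ≢ + 0
    d≢0 d≡0 = proj₂ (differ-at u≢u′) (sym (Fin.toℕ-injective (ℤ.+-injective (ℤ.i-j≡0⇒i≡j _ _ d≡0))))
    top-row : ∀ (x : Fin (suc m) → ℤ) i → sumℤ (suc m) (λ j → B⁺ (i ↑ˡ b) j ℤ.* x j) ≡ top i zero ℤ.* x zero
    top-row x i rewrite Fin.splitAt-↑ˡ a i b =
      trans (cong (λ s → top i zero ℤ.* x zero ℤ.+ s) (sumℤ-0* m (x ∘ suc))) (ℤ.+-identityʳ _)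
    bottom-row : ∀ (x : Fin (suc m) → ℤ) i →
      sumℤ (suc m) (λ j → B⁺ (a ↑ʳ i) j ℤ.* x j) ≡ sumℤ m (λ j → B i j ℤ.* x (suc j))
    bottom-row x i rewrite Fin.splitAt-↑ʳ a b i = ℤ.+-identityˡ _
    head≡ : x zero ≡ y zero
    head≡ = ℤ.*-cancelˡ-≡ d (x zero) (y zero) {{ℤ.≢-nonZero d≢0}}
      (trans (sym (top-row x _)) (trans (same _) (top-row y _)))
    tail≡ : ∀ i → sumℤ m (λ j → B i j ℤ.* x (suc j)) ≡ sumℤ m (λ j → B i j ℤ.* y (suc j))
    tail≡ i = trans (sym (bottom-row x i)) (trans (same _) (bottom-row y i))

  affine-top : ∀ (x : Point (suc m)) i →
    applyAffine B⁺ z⁺ x (i ↑ˡ b) ≡ (1ℚ ℚ.- x zero) ℚ.* ι (coord u i) ℚ.+ x zero ℚ.* ι (coord u′ i)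
  affine-top x i rewrite Fin.splitAt-↑ˡ a i b = begin
    ι c ℚ.+ (ι (c′ ℤ.- c) ℚ.* t ℚ.+ sumℚ m (λ j → 0ℚ ℚ.* x (suc j)))
      ≡⟨ cong (λ s → ι c ℚ.+ (ι (c′ ℤ.- c) ℚ.* t ℚ.+ s)) (sumℚ-0* m (x ∘ suc)) ⟩
    ι c ℚ.+ (ι (c′ ℤ.- c) ℚ.* t ℚ.+ 0ℚ)
      ≡⟨ solve 3 (λ c d t → c :+ (d :* t :+ con 0ℚ) := (con 1ℚ :- t) :* c :+ t :* (c :+ d)) refl (ι c) (ι (c′ ℤ.- c)) t ⟩
    (1ℚ ℚ.- t) ℚ.* ι c ℚ.+ t ℚ.* (ι c ℚ.+ ι (c′ ℤ.- c))
      ≡⟨ cong (λ s → (1ℚ ℚ.- t) ℚ.* ι c ℚ.+ t ℚ.* s) (ι-homo-+ c (c′ ℤ.- c)) ⟨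
    (1ℚ ℚ.- t) ℚ.* ι c ℚ.+ t ℚ.* ι (c ℤ.+ (c′ ℤ.- c))
      ≡⟨ cong (λ s → (1ℚ ℚ.- t) ℚ.* ι c ℚ.+ t ℚ.* ι s) (i+[j-i]≡j c c′) ⟩
    (1ℚ ℚ.- t) ℚ.* ι c ℚ.+ t ℚ.* ι c′ ∎
    where
    open ≡-Reasoning
    open ℚSolver.+-*-Solver
    t = x zero
    c = coord u i
    c′ = coord u′ i

  affine-bottom : ∀ (x : Point (suc m)) i → applyAffine B⁺ z⁺ x (a ↑ʳ i) ≡ applyAffine B z (x ∘ suc) i
  affine-bottom x i rewrite Fin.splitAt-↑ʳ a b i = cong (ι (z i) ℚ.+_)
    (trans (cong (ℚ._+ rest) (ℚ.*-zeroˡ (x zero))) (ℚ.+-identityˡ rest))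
    where
    rest = sumℚ m (λ j → ι (B i j) ℚ.* x (suc j))

  module _ (S : List (Vec (Fin N) (a + b))) (Y : List (Vec (Fin N) b)) where

    -- The weights of `p` over `Y` are moved to the words that prefix `v` to elements of `Y`. The
    -- top coordinates are then constantly those of `v` because the weights sum to 1.
    layer : ∀ v → (∀ y → y ∈ Y → v Vec.++ y ∈ S) → ∀ {p} → InConv Y p →
      InConv S (λ i → [ ι ∘ coord v , p ]′ (splitAt a i))
    layer v vY⊆S {p} (w , w≥0 , ∑w , p≡) =
      InConv-resp S (↑-elim layer-top layer-bottom) (InConv-family S L ρ w w≥0 ∑w)
      where
      open ≡-Reasoning
      L = length Y
      vy∈S : ∀ j → v Vec.++ lookup Y j ∈ S
      vy∈S j = vY⊆S (lookup Y j) (∈-lookup j)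
      ρ : Fin L → Fin (length S)
      ρ j = index (vy∈S j)
      lookup-ρ : ∀ j → lookup S (ρ j) ≡ v Vec.++ lookup Y j
      lookup-ρ j = sym (lookup-index (vy∈S j))
      layer-top : ∀ i → sumℚ L (λ j → w j ℚ.* embed (lookup S (ρ j)) (i ↑ˡ b)) ≡ [ ι ∘ coord v , p ]′ (splitAt a (i ↑ˡ b))
      layer-top i rewrite Fin.splitAt-↑ˡ a i b = begin
        sumℚ L (λ j → w j ℚ.* embed (lookup S (ρ j)) (i ↑ˡ b)) ≡⟨ sumℚ-cong (λ j → cong (λ s → w j ℚ.* ι (+ toℕ s))
          (trans (cong (λ s → Vec.lookup s (i ↑ˡ b)) (lookup-ρ j)) (Vec.lookup-++ˡ v (lookup Y j) i))) ⟩
        sumℚ L (λ j → w j ℚ.* ι (coord v i))                   ≡⟨ sumℚ-*ʳ (ι (coord v i)) w ⟩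
        sumℚ L w ℚ.* ι (coord v i)                             ≡⟨ cong (ℚ._* ι (coord v i)) ∑w ⟩
        1ℚ ℚ.* ι (coord v i)                                   ≡⟨ ℚ.*-identityˡ (ι (coord v i)) ⟩
        ι (coord v i)                                          ∎
      layer-bottom : ∀ i → sumℚ L (λ j → w j ℚ.* embed (lookup S (ρ j)) (a ↑ʳ i)) ≡ [ ι ∘ coord v , p ]′ (splitAt a (a ↑ʳ i))
      layer-bottom i rewrite Fin.splitAt-↑ʳ a b i = begin
        sumℚ L (λ j → w j ℚ.* embed (lookup S (ρ j)) (a ↑ʳ i)) ≡⟨ sumℚ-cong (λ j → cong (λ s → w j ℚ.* ι (+ toℕ s))
          (trans (cong (λ s → Vec.lookup s (a ↑ʳ i)) (lookup-ρ j)) (Vec.lookup-++ʳ v (lookup Y j) i))) ⟩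
        sumℚ L (λ j → w j ℚ.* embed (lookup Y j) i)            ≡⟨ p≡ i ⟨
        p i                                                    ∎

    -- The image of `x` divides, in the ratio given by `x zero`, the segment between the points over
    -- `u` and over `u′` that share the bottom part `p`.
    affine-in-conv : (∀ y → y ∈ Y → u Vec.++ y ∈ S × u′ Vec.++ y ∈ S) →
      (∀ x → InUnitCube x → InConv Y (applyAffine B z x)) →
      ∀ x → InUnitCube x → InConv S (applyAffine B⁺ z⁺ x)
    affine-in-conv both cube x x∈cube = InConv-resp S (↑-elim
      (λ i → trans (mix-top i) (sym (affine-top x i)))
      (λ i → trans (mix-bottom i) (sym (affine-bottom x i))))
      (InConv-convex S (x zero) (proj₁ (x∈cube zero)) (proj₂ (x∈cube zero))
        (layer u (λ y y∈ → proj₁ (both y y∈)) p∈conv) (layer u′ (λ y y∈ → proj₂ (both y y∈)) p∈conv))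
      where
      open ℚSolver.+-*-Solver
      p : Point b
      p = applyAffine B z (x ∘ suc)
      p∈conv : InConv Y p
      p∈conv = cube (x ∘ suc) (x∈cube ∘ suc)
      mix : Fin (a + b) → ℚ
      mix i = (1ℚ ℚ.- x zero) ℚ.* [ ι ∘ coord u , p ]′ (splitAt a i) ℚ.+ x zero ℚ.* [ ι ∘ coord u′ , p ]′ (splitAt a i)
      mix-top : ∀ i → mix (i ↑ˡ b) ≡ (1ℚ ℚ.- x zero) ℚ.* ι (coord u i) ℚ.+ x zero ℚ.* ι (coord u′ i)
      mix-top i rewrite Fin.splitAt-↑ˡ a i b = refl
      mix-bottom : ∀ i → mix (a ↑ʳ i) ≡ p i
      mix-bottom i rewrite Fin.splitAt-↑ʳ a b i =
        solve 2 (λ t p → (con 1ℚ :- t) :* p :+ t :* p := p) refl (x zero) (p i)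

HasCube-prepend : ∀ {N a b m} {u u′ : Vec (Fin N) a} {Y : List (Vec (Fin N) b)} {S : List (Vec (Fin N) (a + b))} →
  u ≢ u′ → (∀ y → y ∈ Y → u Vec.++ y ∈ S × u′ Vec.++ y ∈ S) → HasCube Y m → HasCube S (suc m)
HasCube-prepend {u = u} {u′} {Y} {S} u≢u′ both (B , z , B-inj , cube) =
  B⁺ , z⁺ , B⁺-injective B-inj , affine-in-conv S Y both cube
  where open PrependEdge u u′ u≢u′ B z

HasCube-zero : ∀ {N n} {S : List (Vec (Fin N) n)} {s} → s ∈ S → HasCube S 0
HasCube-zero {S = S} {s} s∈S = (λ i ()) , (λ i → + toℕ (Vec.lookup s i)) , (λ x y _ ()) , λ x _ →
  InConv-resp S (λ i → trans (ℚ.+-identityʳ _) (trans (ℚ.*-identityˡ _)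
      (trans (cong (λ v → embed v i) (sym (lookup-index s∈S))) (sym (ℚ.+-identityʳ _)))))
    (InConv-family S 1 (λ _ → index s∈S) (λ _ → 1ℚ) (λ _ → 0≤1ℚ) (ℚ.+-identityʳ 1ℚ))

-- Dense sets contain cubes

-- Equal to 2 + 4 + ... + 2^K = 2^(K+1) - 2: the total length, in units of the first block, of the
-- `K` blocks that follow it. The last block is never split off; it only pays for the density lost
-- before.
cubeLength : ℕ → ℕ
cubeLength zero    = 0
cubeLength (suc K) = 2 + 2 * cubeLength K

-- Blocks of length a, 2a, 4a, …: each step of the recursion splits off one block and
-- uses up a factor N^(2a) of the density, which the next, twice as long, block absorbs.
large⇒HasCube : ∀ {N} K a r {n} → n ≡ a + (a * cubeLength K + r) → (S : List (Vec (Fin N) n)) → Unique S →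
  K * N ^ (a * cubeLength K + r) < length S → HasCube S K
-- For K = 0 the hypothesis reads `0 < length S`, which rules out the empty list.
large⇒HasCube zero a r n≡ (s ∷ S) uniq large = HasCube-zero {S = s ∷ S} (here refl)
large⇒HasCube {N} (suc K) a r {n} refl S uniq large =
  let u , u′ , u≢u′ , Y , Y-unique , Y-large , both = popular-pair a e M S uniq large′
  in HasCube-prepend u≢u′ both (large⇒HasCube K (a + a) r e≡ Y Y-unique Y-large)
  where
  e e′ M : ℕ
  e = a * cubeLength (suc K) + r
  e′ = (a + a) * cubeLength K + r
  M = K * N ^ e′
  lemma : ∀ a h r → a * (2 + 2 * h) + r ≡ (a + a) + ((a + a) * h + r)
  lemma = ℕSolver.solve-∀
  e≡ : e ≡ (a + a) + e′
  e≡ = lemma a (cubeLength K) r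
  swap : ∀ x y z → x * (y * z) ≡ y * (x * z)
  swap = ℕSolver.solve-∀
  -- Of the `suc K` multiples of `N ^ e` in the hypothesis, one pays for the first words of the
  -- fibres. The other `K` pay for the N^(2a) pairs with `M` suffixes each.
  large′ : N ^ e + N ^ (a + a) * M < length S
  large′ = begin-strict
    N ^ e + N ^ (a + a) * (K * N ^ e′)  ≡⟨ cong (λ t → N ^ e + t) (swap (N ^ (a + a)) K (N ^ e′)) ⟩
    N ^ e + K * (N ^ (a + a) * N ^ e′)  ≡⟨ cong (λ t → N ^ e + K * t) (^-distribˡ-+-* N (a + a) e′) ⟨
    N ^ e + K * N ^ (a + a + e′)        ≡⟨ cong (λ t → N ^ e + K * N ^ t) e≡ ⟨
    suc K * N ^ e                       <⟨ large ⟩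
    length S                            ∎
    where open ≤-Reasoning

n<2^n : ∀ n → n < 2 ^ n
n<2^n zero    = s≤s z≤n
n<2^n (suc n) = begin-strict
  suc n            ≤⟨ n<2^n n ⟩
  2 ^ n            <⟨ m<m+n (2 ^ n) (m^n>0 2 n) ⟩
  2 ^ n + 2 ^ n    ≡⟨ cong (λ t → 2 ^ n + t) (+-identityʳ (2 ^ n)) ⟨
  2 ^ suc n        ∎
  where open ≤-Reasoning

^-distribʳ-* : ∀ m n k → (m * n) ^ k ≡ m ^ k * n ^ k
^-distribʳ-* m n zero    = refl
^-distribʳ-* m n (suc k) = trans (cong (m * n *_) (^-distribʳ-* m n k)) (lemma m n (m ^ k) (n ^ k))
  where
  lemma : ∀ a b c d → a * b * (c * d) ≡ a * c * (b * d)
  lemma = ℕSolver.solve-∀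

-- A density above 1 - 1/(2g) costs at most n/(2g) in the exponent, about half of the block length
-- n/g. The other half absorbs the factor K ≤ N^K and the remainder of n modulo g once n ≥ 2g(K +
-- 1).
dense⇒large : ∀ {N} → 2 ≤ N → ∀ K L n (S : List (Vec (Fin N) n)) → let g = suc L in
  2 * g * suc K ≤ n → DenseAt N n S 1 (2 * g) →
  K * N ^ (n / g * L + n % g) < length S
dense⇒large {N} 2≤N K L n S n-large dense = ≰⇒> λ small → <⇒≱ dense (begin
  length S ^ Q * N ^ (n * 1)              ≡⟨ cong (λ t → length S ^ Q * N ^ t) (*-identityʳ n) ⟩
  length S ^ Q * N ^ n                    ≤⟨ *-monoˡ-≤ (N ^ n) (^-monoˡ-≤ Q small) ⟩
  (K * N ^ e) ^ Q * N ^ n                 ≤⟨ *-monoˡ-≤ (N ^ n) (^-monoˡ-≤ Q (*-monoˡ-≤ (N ^ e) K≤N^K)) ⟩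
  (N ^ K * N ^ e) ^ Q * N ^ n             ≡⟨ cong (λ t → t ^ Q * N ^ n) (^-distribˡ-+-* N K e) ⟨
  (N ^ (K + e)) ^ Q * N ^ n               ≡⟨ cong (_* N ^ n) (^-*-assoc N (K + e) Q) ⟩
  N ^ ((K + e) * Q) * N ^ n               ≡⟨ ^-distribˡ-+-* N ((K + e) * Q) n ⟨
  N ^ ((K + e) * Q + n)                   ≤⟨ ^-monoʳ-≤ N {{>-nonZero (<-trans z<s 2≤N)}} exponents ⟩
  N ^ (n * Q)                             ∎)
  where
  open ≤-Reasoning
  g = suc L
  Q = 2 * g
  a = n / g
  r = n % g
  e = a * L + r
  K≤N^K : K ≤ N ^ K
  K≤N^K = ≤-trans (<⇒≤ (n<2^n K)) (^-monoˡ-≤ K 2≤N)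
  n≡ : n ≡ r + a * g
  n≡ = m≡m%n+[m/n]*n n g
  lemma₁ : ∀ K a L r → (K + (a * L + r)) * (2 * suc L) + 2 * (r + a * suc L)
         ≡ (r + a * suc L) * (2 * suc L) + (2 * suc L * K + 2 * r)
  lemma₁ = ℕSolver.solve-∀
  lemma₂ : ∀ g K → 2 * g * K + 2 * g ≡ 2 * g * suc K
  lemma₂ = ℕSolver.solve-∀
  remainder : 2 * g * K + 2 * r ≤ n
  remainder = begin
    2 * g * K + 2 * r  ≤⟨ +-monoʳ-≤ (2 * g * K) (*-monoʳ-≤ 2 (<⇒≤ (m%n<n n g))) ⟩
    2 * g * K + 2 * g  ≡⟨ lemma₂ g K ⟩
    2 * g * suc K      ≤⟨ n-large ⟩
    n                  ∎
  exponents : (K + e) * Q + n ≤ n * Q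
  exponents = +-cancelʳ-≤ n _ _ (begin
    (K + e) * Q + n + n                  ≡⟨ double ((K + e) * Q) n ⟩
    (K + e) * Q + 2 * n                  ≡⟨ cong (λ t → (K + e) * Q + 2 * t) n≡ ⟩
    (K + e) * Q + 2 * (r + a * g)        ≡⟨ lemma₁ K a L r ⟩
    (r + a * g) * Q + (2 * g * K + 2 * r) ≡⟨ cong (λ t → t * Q + (2 * g * K + 2 * r)) n≡ ⟨
    n * Q + (2 * g * K + 2 * r)          ≤⟨ +-monoʳ-≤ (n * Q) remainder ⟩
    n * Q + n                            ∎)
    where
    double : ∀ x n → x + n + n ≡ x + 2 * n
    double = ℕSolver.solve-∀

dense⇒HasCube : ∀ {N} → 2 ≤ N → (S : (n : ℕ) → List (Vec (Fin N) n)) → ((n : ℕ) → Unique (S n)) →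
  ((p q : ℕ) → (n₀ : ℕ) → Σ ℕ λ n → (n₀ ≤ n) × DenseAt N n (S n) (suc p) (suc q)) →
  (K : ℕ) → (n₀ : ℕ) → Σ ℕ λ n → (n₀ ≤ n) × HasCube (S n) K
dense⇒HasCube 2≤N S uniq dense K n₀ =
  let L = cubeLength K
      g = suc L
      -- After the `suc`s in the hypothesis, `0` and `L + 1 * g` stand for the fraction 1/(2g). The
      -- threshold is a sum so that it yields both `n₀ ≤ n` and the size needed by `dense⇒large`.
      n , n-large , S-dense = dense 0 (L + 1 * g) (n₀ + 2 * g * suc K)
  in n , m+n≤o⇒m≤o n₀ n-large ,
     large⇒HasCube K (n / g) (n % g) (trans (m≡m%n+[m/n]*n n g) (split (n % g) (n / g) L)) (S n) (uniq n)
       (dense⇒large 2≤N K L n (S n) (m+n≤o⇒n≤o n₀ n-large) S-dense)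
  where
  split : ∀ r a L → r + a * suc L ≡ a + (a * L + r)
  split = ℕSolver.solve-∀

-- Dissociated coefficients

⟨_,_⟩ : ∀ {n} → (Fin n → ℕ) → (Fin n → ℤ) → ℤ
⟨_,_⟩ {n} a b = sumℤ n (λ i → + a i ℤ.* b i)

‖_‖ : ∀ {n} → (Fin n → ℤ) → ℕ
‖ b ‖ = ∑ℕ.sum (λ i → ∣ b i ∣)

Dissociated : ∀ {n} → (Fin n → ℕ) → ℕ → Set
Dissociated a s = ∀ b → ‖ b ‖ ≤ s → ⟨ a , b ⟩ ≡ + 0 → ∀ i → b i ≡ + 0

-- An upper bound for the number of lattice points of the ℓ¹-ball, not the exact count: after a step
-- in the first coordinate, the recursion may step back, so points are counted repeatedly. In return
-- the recurrence is linear with two terms, which makes `ballSize-bound` a direct induction.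
ballSize : ℕ → ℕ → ℕ
ballSize zero    s       = 1
ballSize (suc n) zero    = ballSize n zero
ballSize (suc n) (suc s) = ballSize n (suc s) + (ballSize (suc n) s + ballSize (suc n) s)

values : ∀ n → (Fin n → ℕ) → ℕ → List ℤ
values zero    a s       = + 0 ∷ []
values (suc n) a zero    = values n (a ∘ suc) zero
values (suc n) a (suc s) = values n (a ∘ suc) (suc s) ++
  (map (ℤ._+ (+ a zero)) (values (suc n) a s) ++ map (ℤ._- (+ a zero)) (values (suc n) a s))

length-values : ∀ n a s → length (values n a s) ≡ ballSize n s
length-values zero    a s       = refl
length-values (suc n) a zero    = length-values n (a ∘ suc) zero
length-values (suc n) a (suc s) = trans (length-++ (values n (a ∘ suc) (suc s))) (cong₂ _+_
  (length-values n (a ∘ suc) (suc s))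
  (trans (length-++ (map (ℤ._+ (+ a zero)) (values (suc n) a s))) (cong₂ _+_
    (trans (length-map _ (values (suc n) a s)) (length-values (suc n) a s))
    (trans (length-map _ (values (suc n) a s)) (length-values (suc n) a s)))))

neg-suc : ∀ k → -[1+ k ] ≡ ℤ.- + 1 ℤ.+ ℤ.- + k
neg-suc zero    = refl
neg-suc (suc k) = refl

∈-values : ∀ n a s b → ‖ b ‖ ≤ s → ⟨ a , b ⟩ ∈ values n a s
-- Keeping the head entry `c` apart from the tail lets the induction move it one unit towards 0,
-- spending one unit of `s` and one summand `a zero` of either sign, until only the tail is left.
∈-values-cons : ∀ n a s c b → ∣ c ∣ + ‖ b ‖ ≤ s → + a zero ℤ.* c ℤ.+ ⟨ a ∘ suc , b ⟩ ∈ values (suc n) a s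

∈-values zero    a s b _ = here refl
∈-values (suc n) a s b h = ∈-values-cons n a s (b zero) (b ∘ suc) h

∈-values-cons n a s (+ zero) b h = subst (_∈ values (suc n) a s) (sym drop) (keep s h)
  where
  drop : + a zero ℤ.* + 0 ℤ.+ ⟨ a ∘ suc , b ⟩ ≡ ⟨ a ∘ suc , b ⟩
  drop = trans (cong (ℤ._+ ⟨ a ∘ suc , b ⟩) (ℤ.*-zeroʳ (+ a zero))) (ℤ.+-identityˡ _)
  keep : ∀ s → ‖ b ‖ ≤ s → ⟨ a ∘ suc , b ⟩ ∈ values (suc n) a s
  keep zero    h = ∈-values n (a ∘ suc) zero b h
  keep (suc s) h = ∈-++⁺ˡ (∈-values n (a ∘ suc) (suc s) b h)
∈-values-cons n a (suc s) +[1+ k ] b (s≤s h) =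
  subst (_∈ values (suc n) a (suc s)) (sym (lemma (+ a zero) (+ k) ⟨ a ∘ suc , b ⟩))
    (∈-++⁺ʳ (values n (a ∘ suc) (suc s)) (∈-++⁺ˡ (∈-map⁺ (ℤ._+ (+ a zero)) (∈-values-cons n a s (+ k) b h))))
  where
  lemma : ∀ x c y → x ℤ.* (+ 1 ℤ.+ c) ℤ.+ y ≡ (x ℤ.* c ℤ.+ y) ℤ.+ x
  lemma = ℤSolver.solve-∀
∈-values-cons n a (suc s) -[1+ k ] b (s≤s h) =
  subst (_∈ values (suc n) a (suc s)) (sym (trans (cong (λ c → + a zero ℤ.* c ℤ.+ ⟨ a ∘ suc , b ⟩) (neg-suc k))
      (lemma (+ a zero) (ℤ.- + k) ⟨ a ∘ suc , b ⟩)))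
    (∈-++⁺ʳ (values n (a ∘ suc) (suc s)) (∈-++⁺ʳ (map (ℤ._+ (+ a zero)) (values (suc n) a s))
      (∈-map⁺ (ℤ._- (+ a zero)) (∈-values-cons n a s (ℤ.- + k) b
        (subst (λ t → t + ‖ b ‖ ≤ s) (sym (ℤ.∣-i∣≡∣i∣ (+ k))) h)))))
  where
  lemma : ∀ x c y → x ℤ.* (ℤ.- + 1 ℤ.+ c) ℤ.+ y ≡ (x ℤ.* c ℤ.+ y) ℤ.- x
  lemma = ℤSolver.solve-∀

-- A multiplier c + 1 and an element w of `ws` exclude at most one `v`, the solution of (c + 1) v =
-- w. Hence the s * length ws such pairs cannot exclude one more candidate than their number.
fresh-multiple : ∀ s (ws : List ℤ) → ∃ λ v → v ≤ s * length ws ×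
  (∀ c → c < s → ¬ (+[1+ c ] ℤ.* + v ∈ ws))
fresh-multiple s ws with Fin.any? (λ (v : Fin (suc (s * length ws))) → ¬? (bad? (toℕ v)))
  where
  bad? : ∀ v → Dec (∃ λ (c : Fin s) → +[1+ toℕ c ] ℤ.* + v ∈ ws)
  bad? v = Fin.any? (λ c → Any.any? ((+[1+ toℕ c ] ℤ.* + v) ℤ.≟_) ws)
... | yes (v , good) = toℕ v , s≤s⁻¹ (Fin.toℕ<n v) ,
  λ c c<s cv∈ws → good (Fin.fromℕ< c<s ,
    subst (λ k → +[1+ k ] ℤ.* + toℕ v ∈ ws) (sym (Fin.toℕ-fromℕ< c<s)) cv∈ws)
... | no ¬good = contradiction (Fin.toℕ-injective (ℤ.+-injective u≡v)) (Fin.<⇒≢ u<v)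
  where
  bad : ∀ v → ∃ λ (c : Fin s) → +[1+ toℕ c ] ℤ.* + toℕ v ∈ ws
  bad v = decidable-stable (Fin.any? (λ c → Any.any? ((+[1+ toℕ c ] ℤ.* + toℕ v) ℤ.≟_) ws)) (λ good → ¬good (v , good))
  code : Fin (suc (s * length ws)) → Fin (s * length ws)
  code v = combine (proj₁ (bad v)) (index (proj₂ (bad v)))
  collision = Fin.pigeonhole (n<1+n _) code
  u = proj₁ collision
  v = proj₁ (proj₂ collision)
  u<v = proj₁ (proj₂ (proj₂ collision))
  codes≡ = Fin.combine-injective (proj₁ (bad u)) (index (proj₂ (bad u))) (proj₁ (bad v)) (index (proj₂ (bad v)))
    (proj₂ (proj₂ (proj₂ collision)))
  u≡v : + toℕ u ≡ + toℕ v
  u≡v = ℤ.*-cancelˡ-≡ +[1+ toℕ (proj₁ (bad u)) ] (+ toℕ u) (+ toℕ v) (begin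
    +[1+ toℕ (proj₁ (bad u)) ] ℤ.* + toℕ u  ≡⟨ lookup-index (proj₂ (bad u)) ⟩
    lookup ws (index (proj₂ (bad u)))       ≡⟨ cong (lookup ws) (proj₂ codes≡) ⟩
    lookup ws (index (proj₂ (bad v)))       ≡⟨ lookup-index (proj₂ (bad v)) ⟨
    +[1+ toℕ (proj₁ (bad v)) ] ℤ.* + toℕ v  ≡⟨ cong (λ c → +[1+ toℕ c ] ℤ.* + toℕ v) (proj₁ codes≡) ⟨
    +[1+ toℕ (proj₁ (bad u)) ] ℤ.* + toℕ v  ∎)
    where open ≡-Reasoning

⟨,⟩-neg : ∀ {n} (a : Fin n → ℕ) b → ⟨ a , (λ i → ℤ.- b i) ⟩ ≡ ℤ.- ⟨ a , b ⟩
⟨,⟩-neg {zero}  a b = refl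
⟨,⟩-neg {suc n} a b = trans (cong₂ ℤ._+_ (sym (ℤ.neg-distribʳ-* (+ a zero) (b zero))) (⟨,⟩-neg (a ∘ suc) (b ∘ suc)))
  (sym (ℤ.neg-distrib-+ (+ a zero ℤ.* b zero) ⟨ a ∘ suc , b ∘ suc ⟩))

‖-‖-neg : ∀ {n} (b : Fin n → ℤ) → ‖ (λ i → ℤ.- b i) ‖ ≡ ‖ b ‖
‖-‖-neg b = ∑ℕ.sum-cong-≗ (λ i → ℤ.∣-i∣≡∣i∣ (b i))

_∷ᶠ_ : ∀ {n} → ℕ → (Fin n → ℕ) → Fin (suc n) → ℕ
(v ∷ᶠ a) zero    = v
(v ∷ᶠ a) (suc i) = a i

-- A relation with nonzero head entry would make a multiple of `v`, by a factor between 1 and `s`,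
-- equal to plus or minus the value of `a` on the tail. Since the ball is symmetric, both signs are
-- listed in `values`, against freshness. With zero head entry the relation is one for `a`.
dissociated-extend : ∀ {n} (a : Fin n → ℕ) s v → Dissociated a s →
  (∀ c → c < s → ¬ (+[1+ c ] ℤ.* + v ∈ values n a s)) → Dissociated (v ∷ᶠ a) s
dissociated-extend {n} a s v dis fresh b ‖b‖≤s eq = go (b zero) refl
  where
  b′ : Fin n → ℤ
  b′ = b ∘ suc
  head≤ : ∣ b zero ∣ ≤ s
  head≤ = m+n≤o⇒m≤o ∣ b zero ∣ ‖b‖≤s
  tail≤ : ‖ b′ ‖ ≤ s
  tail≤ = m+n≤o⇒n≤o ∣ b zero ∣ ‖b‖≤s
  split : ∀ c → b zero ≡ c → + v ℤ.* c ℤ.+ ⟨ a , b′ ⟩ ≡ + 0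
  split c b₀≡c = trans (cong (λ c → + v ℤ.* c ℤ.+ ⟨ a , b′ ⟩) (sym b₀≡c)) eq
  go : ∀ c → b zero ≡ c → ∀ i → b i ≡ + 0
  go (+ zero) b₀≡ zero    = b₀≡
  go (+ zero) b₀≡ (suc i) = dis b′ tail≤ (begin
    ⟨ a , b′ ⟩                      ≡⟨ ℤ.+-identityˡ _ ⟨
    + 0 ℤ.+ ⟨ a , b′ ⟩              ≡⟨ cong (ℤ._+ ⟨ a , b′ ⟩) (ℤ.*-zeroʳ (+ v)) ⟨
    + v ℤ.* + 0 ℤ.+ ⟨ a , b′ ⟩      ≡⟨ split _ b₀≡ ⟩
    + 0                             ∎) i
    where open ≡-Reasoning
  go +[1+ k ] b₀≡ _ = contradiction
    (subst (_∈ values n a s) (trans (⟨,⟩-neg a b′) (lemma (+ v) +[1+ k ] ⟨ a , b′ ⟩ (split _ b₀≡)))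
      (∈-values n a s (λ i → ℤ.- b′ i) (subst (_≤ s) (sym (‖-‖-neg b′)) tail≤)))
    (fresh k (subst (λ c → ∣ c ∣ ≤ s) b₀≡ head≤))
    where
    lemma : ∀ x c y → x ℤ.* c ℤ.+ y ≡ + 0 → ℤ.- y ≡ c ℤ.* x
    lemma x c y e = trans (identity x c y) (trans (cong (λ t → c ℤ.* x ℤ.- t) e) (ℤ.+-identityʳ (c ℤ.* x)))
      where
      identity : ∀ x c y → ℤ.- y ≡ c ℤ.* x ℤ.- (x ℤ.* c ℤ.+ y)
      identity = ℤSolver.solve-∀
  go -[1+ k ] b₀≡ _ = contradiction
    (subst (_∈ values n a s) (lemma (+ v) +[1+ k ] ⟨ a , b′ ⟩ (split _ b₀≡)) (∈-values n a s b′ tail≤))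
    (fresh k (subst (λ c → ∣ c ∣ ≤ s) b₀≡ head≤))
    where
    lemma : ∀ x c y → x ℤ.* (ℤ.- c) ℤ.+ y ≡ + 0 → y ≡ c ℤ.* x
    lemma x c y e = trans (identity x c y) (trans (cong (λ t → c ℤ.* x ℤ.+ t) e) (ℤ.+-identityʳ (c ℤ.* x)))
      where
      identity : ∀ x c y → y ≡ c ℤ.* x ℤ.+ (x ℤ.* (ℤ.- c) ℤ.+ y)
      identity = ℤSolver.solve-∀

ballSize-mono : ∀ n s → ballSize n s ≤ ballSize (suc n) s
ballSize-mono n zero    = ≤-refl
ballSize-mono n (suc s) = m≤m+n _ _

-- Each new entry has to avoid only the values on a ball of one dimension less; monotonicity of
-- `ballSize` makes the resulting bound uniform over all entries.
dissociated-exists : ∀ n s → ∃ λ (a : Fin n → ℕ) → (∀ i → a i ≤ s * ballSize n s) × Dissociated a s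
dissociated-exists zero    s = (λ ()) , (λ ()) , λ _ _ _ ()
dissociated-exists (suc n) s with a , a≤ , dis ← dissociated-exists n s
  with v , v≤ , fresh ← fresh-multiple s (values n a s) =
  v ∷ᶠ a ,
  (λ { zero    → ≤-trans (subst (λ l → v ≤ s * l) (length-values n a s) v≤) grow
     ; (suc i) → ≤-trans (a≤ i) grow }) ,
  dissociated-extend a s v dis fresh
  where
  grow : s * ballSize n s ≤ s * ballSize (suc n) s
  grow = *-monoʳ-≤ s (ballSize-mono n s)

-- Cubes in level sets

vecℤ : ∀ {N n} → Vec (Fin N) n → Fin n → ℤ
vecℤ v i = + toℕ (Vec.lookup v i)

sumℤ-distrib-+ : ∀ {k} (f g : Fin k → ℤ) → sumℤ k (λ i → f i ℤ.+ g i) ≡ sumℤ k f ℤ.+ sumℤ k g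
sumℤ-distrib-+ {k} f g = trans (sumℤ≡sum k (λ i → f i ℤ.+ g i))
  (trans (∑ℤ.∑-distrib-+ f g) (cong₂ ℤ._+_ (sym (sumℤ≡sum k f)) (sym (sumℤ≡sum k g))))

sumℤ-cong : ∀ {k} {f g : Fin k → ℤ} → (∀ i → f i ≡ g i) → sumℤ k f ≡ sumℤ k g
sumℤ-cong {zero}  f≗g = refl
sumℤ-cong {suc k} f≗g = cong₂ ℤ._+_ (f≗g zero) (sumℤ-cong (f≗g ∘ suc))

sumℤ-*0 : ∀ k (f : Fin k → ℤ) → sumℤ k (λ i → f i ℤ.* + 0) ≡ + 0
sumℤ-*0 k f = trans (sumℤ-cong (λ i → ℤ.*-comm (f i) (+ 0))) (sumℤ-0* k f)

+-sum : ∀ {k} (f : Fin k → ℕ) → + ∑ℕ.sum f ≡ sumℤ k (λ i → + f i)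
+-sum {zero}  f = refl
+-sum {suc k} f = trans (ℤ.pos-+ (f zero) _) (cong (λ s → + f zero ℤ.+ s) (+-sum (f ∘ suc)))

unit : ∀ {k} → Fin k → Fin k → ℤ
unit zero    zero    = + 1
unit zero    (suc j) = + 0
unit (suc i) zero    = + 0
unit (suc i) (suc j) = unit i j

unit-diag : ∀ {k} (i : Fin k) → unit i i ≡ + 1
unit-diag zero    = refl
unit-diag (suc i) = unit-diag i

sumℤ-unit : ∀ {k} (f : Fin k → ℤ) (i : Fin k) → sumℤ k (λ j → f j ℤ.* unit i j) ≡ f i
sumℤ-unit {suc k} f zero = trans (cong₂ ℤ._+_ (ℤ.*-identityʳ (f zero)) (sumℤ-*0 k (f ∘ suc))) (ℤ.+-identityʳ (f zero))
sumℤ-unit {suc k} f (suc i) = trans (cong₂ ℤ._+_ (ℤ.*-zeroʳ (f zero)) (sumℤ-unit (f ∘ suc) i)) (ℤ.+-identityˡ (f (suc i)))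

Is01 : ℤ → Set
Is01 x = + 0 ℤ.≤ x × x ℤ.≤ + 1

0-is01 : Is01 (+ 0)
0-is01 = ℤ.≤-refl , ℤ.+≤+ z≤n

1-is01 : Is01 (+ 1)
1-is01 = ℤ.+≤+ z≤n , ℤ.≤-refl

unit-is01 : ∀ {k} (i j : Fin k) → Is01 (unit i j)
unit-is01 zero    zero    = 1-is01
unit-is01 zero    (suc j) = 0-is01
unit-is01 (suc i) zero    = 0-is01
unit-is01 (suc i) (suc j) = unit-is01 i j

-- Applied along a row of `B`, these give the vertices of the unit cube where that row is maximal
-- and minimal.
posInd negInd : ℤ → ℤ
posInd +[1+ _ ]  = + 1
posInd (+ zero)  = + 0
posInd -[1+ _ ]  = + 0
negInd +[1+ _ ]  = + 0
negInd (+ zero)  = + 0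
negInd -[1+ _ ]  = + 1

posInd-is01 : ∀ b → Is01 (posInd b)
posInd-is01 +[1+ _ ] = 1-is01
posInd-is01 (+ zero) = 0-is01
posInd-is01 -[1+ _ ] = 0-is01

negInd-is01 : ∀ b → Is01 (negInd b)
negInd-is01 +[1+ _ ] = 0-is01
negInd-is01 (+ zero) = 0-is01
negInd-is01 -[1+ _ ] = 1-is01

*-posInd : ∀ b → b ℤ.* posInd b ≡ b ℤ.* negInd b ℤ.+ + ∣ b ∣
*-posInd +[1+ k ] = trans (ℤ.*-identityʳ +[1+ k ])
  (sym (trans (cong (λ t → t ℤ.+ +[1+ k ]) (ℤ.*-zeroʳ +[1+ k ])) (ℤ.+-identityˡ +[1+ k ])))
*-posInd (+ zero) = refl
*-posInd -[1+ k ] = trans (ℤ.*-zeroʳ -[1+ k ])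
  (sym (trans (cong (λ t → t ℤ.+ +[1+ k ]) (ℤ.*-identityʳ -[1+ k ])) (ℤ.+-inverseˡ +[1+ k ])))

module _ {N n : ℕ} (S : List (Vec (Fin N) n)) {p : Point n} (p∈conv : InConv S p) where

  private
    L = length S
    w = proj₁ p∈conv
    w≥0 = proj₁ (proj₂ p∈conv)
    ∑w = proj₁ (proj₂ (proj₂ p∈conv))
    p≡ = proj₂ (proj₂ (proj₂ p∈conv))

  conv-lower : ∀ i → 0ℚ ℚ.≤ p i
  conv-lower i = subst (0ℚ ℚ.≤_) (sym (p≡ i)) (sumℚ-nonNeg {L}
    (λ k → *-nonNeg (w≥0 k) (ι-mono-≤ {+ 0} {vecℤ (lookup S k) i} (ℤ.+≤+ z≤n))))

  conv-upper : ∀ i → p i ℚ.≤ ι (+ N)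
  conv-upper i = begin
    p i                                             ≡⟨ p≡ i ⟩
    sumℚ L (λ k → w k ℚ.* embed (lookup S k) i)     ≤⟨ sumℚ-mono {L} (λ k →
      ℚ.*-monoˡ-≤-nonNeg (w k) {{ℚ.nonNegative (w≥0 k)}} (ι-mono-≤ {vecℤ (lookup S k) i} {+ N} (ℤ.+≤+ (<⇒≤ (Fin.toℕ<n (Vec.lookup (lookup S k) i)))))) ⟩
    sumℚ L (λ k → w k ℚ.* ι (+ N))                  ≡⟨ sumℚ-*ʳ (ι (+ N)) w ⟩
    sumℚ L w ℚ.* ι (+ N)                            ≡⟨ cong (ℚ._* ι (+ N)) ∑w ⟩
    1ℚ ℚ.* ι (+ N)                                  ≡⟨ ℚ.*-identityˡ (ι (+ N)) ⟩
    ι (+ N)                                         ∎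
    where open ℚ.≤-Reasoning

  conv-linear : ∀ (a : Fin n → ℕ) c → (∀ {v} → v ∈ S → ⟨ a , vecℤ v ⟩ ≡ c) →
    sumℚ n (λ i → ι (+ a i) ℚ.* p i) ≡ ι c
  conv-linear a c const = begin
    sumℚ n (λ i → ι (+ a i) ℚ.* p i)                                ≡⟨ sumℚ-cong (λ i → cong (ι (+ a i) ℚ.*_) (p≡ i)) ⟩
    sumℚ n (λ i → ι (+ a i) ℚ.* sumℚ L (λ k → w k ℚ.* e k i))       ≡⟨ sumℚ-cong (λ i → sumℚ-*ˡ (ι (+ a i)) (λ k → w k ℚ.* e k i)) ⟨
    sumℚ n (λ i → sumℚ L (λ k → ι (+ a i) ℚ.* (w k ℚ.* e k i)))     ≡⟨ sumℚ-comm {n} {L} _ ⟩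
    sumℚ L (λ k → sumℚ n (λ i → ι (+ a i) ℚ.* (w k ℚ.* e k i)))     ≡⟨ sumℚ-cong {L} (λ k → sumℚ-cong {n} (λ i → exchange (ι (+ a i)) (w k) (e k i))) ⟩
    sumℚ L (λ k → sumℚ n (λ i → w k ℚ.* (ι (+ a i) ℚ.* e k i)))     ≡⟨ sumℚ-cong {L} (λ k → sumℚ-*ˡ (w k) (λ i → ι (+ a i) ℚ.* e k i)) ⟩
    sumℚ L (λ k → w k ℚ.* sumℚ n (λ i → ι (+ a i) ℚ.* e k i))       ≡⟨ sumℚ-cong {L} (λ k → cong (w k ℚ.*_) (value k)) ⟩
    sumℚ L (λ k → w k ℚ.* ι c)                                      ≡⟨ sumℚ-*ʳ (ι c) w ⟩
    sumℚ L w ℚ.* ι c                                                ≡⟨ cong (ℚ._* ι c) ∑w ⟩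
    1ℚ ℚ.* ι c                                                      ≡⟨ ℚ.*-identityˡ (ι c) ⟩
    ι c                                                             ∎
    where
    open ≡-Reasoning
    e : Fin L → Fin n → ℚ
    e k i = ι (vecℤ (lookup S k) i)
    exchange : ∀ x y z → x ℚ.* (y ℚ.* z) ≡ y ℚ.* (x ℚ.* z)
    exchange x y z = trans (sym (ℚ.*-assoc x y z)) (trans (cong (ℚ._* z) (ℚ.*-comm x y)) (ℚ.*-assoc y x z))
    value : ∀ k → sumℚ n (λ i → ι (+ a i) ℚ.* e k i) ≡ ι c
    value k = begin
      sumℚ n (λ i → ι (+ a i) ℚ.* e k i)                ≡⟨ sumℚ-cong (λ i → ι-homo-* (+ a i) (vecℤ (lookup S k) i)) ⟨
      sumℚ n (λ i → ι (+ a i ℤ.* vecℤ (lookup S k) i))  ≡⟨ ι-sum n _ ⟨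
      ι ⟨ a , vecℤ (lookup S k) ⟩                       ≡⟨ cong ι (const (∈-lookup k)) ⟩
      ι c                                               ∎

module CubeBound {N n m : ℕ} (S : List (Vec (Fin N) n)) (a : Fin n → ℕ) (c : ℤ)
  (constant : ∀ {v} → v ∈ S → ⟨ a , vecℤ v ⟩ ≡ c)
  (B : Matrix n m) (z : Fin n → ℤ) (B-inj : InjectiveMatrix B)
  (cube : ∀ x → InUnitCube x → InConv S (applyAffine B z x)) where

  -- The bound on `m` uses only vertices of the cube. There the affine map is integer valued, so
  -- what is known about the hull over ℚ can be read back in ℤ.
  image : (Fin m → ℤ) → Fin n → ℤ
  image χ i = z i ℤ.+ sumℤ m (λ j → B i j ℤ.* χ j)

  affine-ι : ∀ χ i → applyAffine B z (ι ∘ χ) i ≡ ι (image χ i)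
  affine-ι χ i = sym (begin
    ι (z i ℤ.+ sumℤ m (λ j → B i j ℤ.* χ j))         ≡⟨ ι-homo-+ (z i) _ ⟩
    ι (z i) ℚ.+ ι (sumℤ m (λ j → B i j ℤ.* χ j))     ≡⟨ cong (ι (z i) ℚ.+_) (ι-sum m _) ⟩
    ι (z i) ℚ.+ sumℚ m (λ j → ι (B i j ℤ.* χ j))     ≡⟨ cong (ι (z i) ℚ.+_) (sumℚ-cong {m} (λ j → ι-homo-* (B i j) (χ j))) ⟩
    applyAffine B z (ι ∘ χ) i                        ∎)
    where open ≡-Reasoning

  module _ {χ : Fin m → ℤ} (χ01 : ∀ j → Is01 (χ j)) where

    vertex∈conv : InConv S (ι ∘ image χ)
    vertex∈conv = InConv-resp S (affine-ι χ)
      (cube (ι ∘ χ) (λ j → ι-mono-≤ (proj₁ (χ01 j)) , ι-mono-≤ (proj₂ (χ01 j))))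

    vertex-lower : ∀ i → + 0 ℤ.≤ image χ i
    vertex-lower i = ι-cancel-≤ {+ 0} {image χ i} (conv-lower S vertex∈conv i)

    vertex-upper : ∀ i → image χ i ℤ.≤ + N
    vertex-upper i = ι-cancel-≤ {image χ i} {+ N} (conv-upper S vertex∈conv i)

    vertex-linear : ⟨ a , image χ ⟩ ≡ c
    vertex-linear = ι-injective (begin
      ι ⟨ a , image χ ⟩                            ≡⟨ ι-sum n _ ⟩
      sumℚ n (λ i → ι (+ a i ℤ.* image χ i))       ≡⟨ sumℚ-cong (λ i → ι-homo-* (+ a i) (image χ i)) ⟩
      sumℚ n (λ i → ι (+ a i) ℚ.* ι (image χ i))   ≡⟨ conv-linear S vertex∈conv a c constant ⟩
      ι c                                          ∎)
      where open ≡-Reasoning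

  -- The images of the origin and of the j-th unit vector lie on the same level of `a`, and their
  -- difference is the column.
  column-in-kernel : ∀ j → ⟨ a , (λ i → B i j) ⟩ ≡ + 0
  column-in-kernel j = ∸-cancel (begin
    ⟨ a , image (λ _ → + 0) ⟩ ℤ.+ ⟨ a , (λ i → B i j) ⟩
      ≡⟨ sumℤ-distrib-+ (λ i → + a i ℤ.* image (λ _ → + 0) i) (λ i → + a i ℤ.* B i j) ⟨
    sumℤ n (λ i → + a i ℤ.* image (λ _ → + 0) i ℤ.+ + a i ℤ.* B i j)
      ≡⟨ sumℤ-cong (λ i → trans (sym (ℤ.*-distribˡ-+ (+ a i) (image (λ _ → + 0) i) (B i j))) (cong (λ t → + a i ℤ.* t) (shift i))) ⟩
    ⟨ a , image (unit j) ⟩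
      ≡⟨ vertex-linear (unit-is01 j) ⟩
    c
      ≡⟨ vertex-linear (λ _ → 0-is01) ⟨
    ⟨ a , image (λ _ → + 0) ⟩ ∎)
    where
    open ≡-Reasoning
    ∸-cancel : ∀ {x y} → x ℤ.+ y ≡ x → y ≡ + 0
    ∸-cancel {x} {y} e = trans (identity x y) (trans (cong (ℤ._- x) e) (ℤ.+-inverseʳ x))
      where
      identity : ∀ x y → y ≡ (x ℤ.+ y) ℤ.- x
      identity = ℤSolver.solve-∀
    shift : ∀ i → image (λ _ → + 0) i ℤ.+ B i j ≡ image (unit j) i
    shift i = cong₂ ℤ._+_
      (trans (cong (λ s → z i ℤ.+ s) (sumℤ-*0 m (B i))) (ℤ.+-identityʳ (z i)))
      (sym (sumℤ-unit (B i) j))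

  -- The vertices selected by the positive and by the negative entries of the row differ by its ℓ¹-norm.
  row-norm : ∀ i → ‖ B i ‖ ≤ N
  row-norm i = ℤ.drop‿+≤+ (begin
    + ‖ B i ‖                            ≡⟨ ℤ.+-identityˡ (+ ‖ B i ‖) ⟨
    + 0 ℤ.+ + ‖ B i ‖                    ≤⟨ ℤ.+-monoˡ-≤ (+ ‖ B i ‖) (vertex-lower (λ j → negInd-is01 (B i j)) i) ⟩
    image χ⁻ i ℤ.+ + ‖ B i ‖             ≡⟨ ℤ.+-assoc (z i) _ _ ⟩
    z i ℤ.+ (sumℤ m (λ j → B i j ℤ.* χ⁻ j) ℤ.+ + ‖ B i ‖)  ≡⟨ cong (λ s → z i ℤ.+ s) gap ⟩
    image χ⁺ i                           ≤⟨ vertex-upper (λ j → posInd-is01 (B i j)) i ⟩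
    + N                                  ∎)
    where
    open ℤ.≤-Reasoning
    χ⁺ χ⁻ : Fin m → ℤ
    χ⁺ j = posInd (B i j)
    χ⁻ j = negInd (B i j)
    gap : sumℤ m (λ j → B i j ℤ.* χ⁻ j) ℤ.+ + ‖ B i ‖ ≡ sumℤ m (λ j → B i j ℤ.* χ⁺ j)
    gap = trans (cong (λ s → sumℤ m (λ j → B i j ℤ.* χ⁻ j) ℤ.+ s) (+-sum {m} (λ j → ∣ B i j ∣)))
      (trans (sym (sumℤ-distrib-+ (λ j → B i j ℤ.* χ⁻ j) (λ j → + ∣ B i j ∣))) (sumℤ-cong (λ j → sym (*-posInd (B i j)))))

  -- Otherwise the j-th unit vector and the origin would have the same image under `B`.
  column-nonzero : ∀ j → ¬ (∀ i → B i j ≡ + 0)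
  column-nonzero j zero-column = contradiction
    (trans (sym (unit-diag j)) (B-inj (unit j) (λ _ → + 0) (λ i →
      trans (sumℤ-unit (B i) j) (trans (zero-column i) (sym (sumℤ-*0 m (B i))))) j))
    λ ()

  column-norm : ∀ {s} → Dissociated a s → ∀ j → suc s ≤ ‖ (λ i → B i j) ‖
  column-norm dis j = ≰⇒> λ short → column-nonzero j (dis (λ i → B i j) short (column-in-kernel j))

sum-upper : ∀ {k} (f : Fin k → ℕ) c → (∀ i → f i ≤ c) → ∑ℕ.sum f ≤ k * c
sum-upper {zero}  f c f≤c = z≤n
sum-upper {suc k} f c f≤c = +-mono-≤ (f≤c zero) (sum-upper (f ∘ suc) c (f≤c ∘ suc))

sum-lower : ∀ {k} (f : Fin k → ℕ) c → (∀ i → c ≤ f i) → k * c ≤ ∑ℕ.sum f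
sum-lower {zero}  f c c≤f = z≤n
sum-lower {suc k} f c c≤f = +-mono-≤ (c≤f zero) (sum-lower (f ∘ suc) c (c≤f ∘ suc))

-- Double counting of the sum of all ∣ B i j ∣, by columns from below and by rows from above.
cube-bound : ∀ {N n} (S : List (Vec (Fin N) n)) a c {s m} → (∀ {v} → v ∈ S → ⟨ a , vecℤ v ⟩ ≡ c) →
  Dissociated a s → HasCube S m → m * suc s ≤ n * N
cube-bound {N} {n} S a c {s} {m} constant dis (B , z , B-inj , cube) = begin
  m * suc s                                 ≤⟨ sum-lower (λ j → ‖ (λ i → B i j) ‖) (suc s) (column-norm dis) ⟩
  ∑ℕ.sum (λ j → ‖ (λ i → B i j) ‖)            ≡⟨ ∑ℕ.∑-comm (λ i j → ∣ B i j ∣) ⟨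
  ∑ℕ.sum (λ i → ‖ B i ‖)                      ≤⟨ sum-upper (λ i → ‖ B i ‖) N row-norm ⟩
  n * N                                     ∎
  where
  open ≤-Reasoning
  open CubeBound S a c constant B z B-inj cube

-- Size of the level sets

ballSize≥1 : ∀ n s → 1 ≤ ballSize n s
ballSize≥1 zero    s       = ≤-refl
ballSize≥1 (suc n) zero    = ballSize≥1 n zero
ballSize≥1 (suc n) (suc s) = m≤n⇒m≤n+o _ (ballSize≥1 n (suc s))

-- The recurrence f(n,s) = f(n-1,s) + 2 f(n,s-1) propagates a bound x^n y^s as soon as 1/x + 2/y ≤
-- 1. Here x = (R+1)/R and y = 2(R+1) give equality; large `R` makes the rate in n small.
ballSize-bound : ∀ R n s → ballSize n s * R ^ n ≤ suc R ^ n * (2 * suc R) ^ s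
ballSize-bound R zero s = subst (1 ≤_) (sym (*-identityˡ _)) (m^n>0 (2 * suc R) s)
ballSize-bound R (suc n) zero = begin
  ballSize n 0 * (R * R ^ n)      ≡⟨ swap (ballSize n 0) R (R ^ n) ⟩
  R * (ballSize n 0 * R ^ n)      ≤⟨ *-mono-≤ (n≤1+n R) (ballSize-bound R n 0) ⟩
  suc R * (suc R ^ n * 1)         ≡⟨ *-assoc (suc R) (suc R ^ n) 1 ⟨
  suc R ^ suc n * 1               ∎
  where
  open ≤-Reasoning
  swap : ∀ x y z → x * (y * z) ≡ y * (x * z)
  swap = ℕSolver.solve-∀
ballSize-bound R (suc n) (suc s) = begin
  (f + (g + g)) * (R * R ^ n)                                   ≡⟨ expand f g R (R ^ n) ⟩
  R * (f * R ^ n) + 2 * (g * (R * R ^ n))                       ≤⟨ +-mono-≤ (*-monoʳ-≤ R (ballSize-bound R n (suc s)))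
                                                                     (*-monoʳ-≤ 2 (ballSize-bound R (suc n) s)) ⟩
  R * (suc R ^ n * β ^ suc s) + 2 * (suc R * suc R ^ n * β ^ s) ≡⟨ collect R (suc R ^ n) (β ^ s) ⟩
  suc R ^ suc n * β ^ suc s                                     ∎
  where
  open ≤-Reasoning
  f = ballSize n (suc s)
  g = ballSize (suc n) s
  β = 2 * suc R
  expand : ∀ f g R x → (f + (g + g)) * (R * x) ≡ R * (f * x) + 2 * (g * (R * x))
  expand = ℕSolver.solve-∀
  collect : ∀ R x y → R * (x * (2 * suc R * y)) + 2 * (suc R * x * y) ≡ suc R * x * (2 * suc R * y)
  collect = ℕSolver.solve-∀

-- Division-free form of (1 + 1/R)^t ≤ 1/(1 - t/R), with d = R - t. The induction step is (R + 1) d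
-- ≤ R (d + 1), which holds because d ≤ R.
bernoulli : ∀ R t d → t + d ≡ R → suc R ^ t * d ≤ R * R ^ t
bernoulli R zero d refl = ≤-reflexive (trans (*-identityˡ d) (sym (*-identityʳ d)))
bernoulli R (suc t) d t+d≡R = begin
  suc R * suc R ^ t * d          ≡⟨ swap (suc R) (suc R ^ t) d ⟩
  suc R ^ t * (suc R * d)        ≤⟨ *-monoʳ-≤ (suc R ^ t) (+-monoˡ-≤ (R * d) (subst (d ≤_) t+d≡R (m≤n+m d (suc t)))) ⟩
  suc R ^ t * (R + R * d)        ≡⟨ factor (suc R ^ t) R d ⟩
  R * (suc R ^ t * suc d)        ≤⟨ *-monoʳ-≤ R (bernoulli R t (suc d) (trans (+-suc t d) t+d≡R)) ⟩
  R * (R * R ^ t)                ∎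
  where
  open ≤-Reasoning
  swap : ∀ x y z → x * y * z ≡ y * (x * z)
  swap = ℕSolver.solve-∀
  factor : ∀ x R d → x * (R + R * d) ≡ R * (x * suc d)
  factor = ℕSolver.solve-∀

-- The midpoint t = d = T of `bernoulli`, where R/d = 2; this is the reason for taking R = 2T.
1+2T^T≤2[2T]^T : ∀ T .{{_ : NonZero T}} → suc (2 * T) ^ T ≤ 2 * (2 * T) ^ T
1+2T^T≤2[2T]^T T = *-cancelʳ-≤ _ _ T (begin
  suc (2 * T) ^ T * T        ≤⟨ bernoulli (2 * T) T T (cong (λ t → T + t) (sym (+-identityʳ T))) ⟩
  2 * T * (2 * T) ^ T        ≡⟨ swap T ((2 * T) ^ T) ⟩
  2 * (2 * T) ^ T * T        ∎)
  where
  open ≤-Reasoning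
  swap : ∀ T x → 2 * T * x ≡ 2 * x * T
  swap = ℕSolver.solve-∀

^-swap : ∀ m k l → (m ^ k) ^ l ≡ (m ^ l) ^ k
^-swap m k l = trans (^-*-assoc m k l) (trans (cong (m ^_) (*-comm k l)) (sym (^-*-assoc m l k)))

-- With u = n / W, each factor n + 1 is at most W 2^u, and for large n the constant N W² is at most
-- 2^u. The three factors 2^u explain the 3 in W = 3T.
polynomial≤exponential : ∀ N T .{{_ : NonZero T}} n → let W = 3 * T in
  N * (W * W) * W ≤ n → (N * (suc n * suc n)) ^ T ≤ 2 ^ n
polynomial≤exponential N T@(suc _) n n-large = begin
  (N * (suc n * suc n)) ^ T                    ≤⟨ ^-monoˡ-≤ T (*-monoʳ-≤ N (*-mono-≤ 1+n≤ 1+n≤)) ⟩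
  (N * (W * 2 ^ u * (W * 2 ^ u))) ^ T          ≡⟨ cong (_^ T) (rearrange N W (2 ^ u)) ⟩
  (N * (W * W) * (2 ^ u * 2 ^ u)) ^ T          ≤⟨ ^-monoˡ-≤ T (*-monoˡ-≤ (2 ^ u * 2 ^ u) NWW≤) ⟩
  (2 ^ u * (2 ^ u * 2 ^ u)) ^ T                ≡⟨ cong (λ t → (2 ^ u * (2 ^ u * t)) ^ T) (*-identityʳ (2 ^ u)) ⟨
  ((2 ^ u) ^ 3) ^ T                            ≡⟨ ^-*-assoc (2 ^ u) 3 T ⟩
  (2 ^ u) ^ W                                  ≡⟨ ^-*-assoc 2 u W ⟩
  2 ^ (u * W)                                  ≤⟨ ^-monoʳ-≤ 2 (m/n*n≤m n W) ⟩
  2 ^ n                                        ∎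
  where
  open ≤-Reasoning
  W = 3 * T
  u = n / W
  1+n≤ : suc n ≤ W * 2 ^ u
  1+n≤ = begin
    suc n                    ≡⟨ cong suc (m≡m%n+[m/n]*n n W) ⟩
    suc (n % W) + u * W      ≤⟨ +-monoˡ-≤ (u * W) (m%n<n n W) ⟩
    suc u * W                ≡⟨ *-comm (suc u) W ⟩
    W * suc u                ≤⟨ *-monoʳ-≤ W (n<2^n u) ⟩
    W * 2 ^ u                ∎
  NWW≤ : N * (W * W) ≤ 2 ^ u
  NWW≤ = begin
    N * (W * W)              ≡⟨ m*n/n≡m (N * (W * W)) W ⟨
    N * (W * W) * W / W      ≤⟨ /-monoˡ-≤ W n-large ⟩
    u                        ≤⟨ <⇒≤ (n<2^n u) ⟩
    2 ^ u                    ∎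
  rearrange : ∀ N W x → N * (W * x * (W * x)) ≡ N * (W * W) * (x * x)
  rearrange = ℕSolver.solve-∀

-- The ℓ¹-balls have radius s = n / period T; this makes the T-th power of their size at most 4ⁿ.
period : ℕ → ℕ
period T = 2 * suc (2 * T) * T

-- One factor 2^n bounds the T-th power of (1 + 1/R)^n. The other bounds that of β^s, by β < 2^β and
-- because `period T` is β T.
ballSize-power : ∀ T .{{_ : NonZero T}} n s → s * period T ≤ n → ballSize n s ^ T ≤ 2 ^ n * 2 ^ n
ballSize-power T@(suc _) n s s-small = *-cancelʳ-≤ _ _ ((R ^ T) ^ n) {{>-nonZero (m^n>0 (R ^ T) {{>-nonZero (m^n>0 R T)}} n)}} (begin
  ballSize n s ^ T * (R ^ T) ^ n                      ≡⟨ cong (ballSize n s ^ T *_) (^-swap R T n) ⟩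
  ballSize n s ^ T * (R ^ n) ^ T                      ≡⟨ ^-distribʳ-* (ballSize n s) (R ^ n) T ⟨
  (ballSize n s * R ^ n) ^ T                          ≤⟨ ^-monoˡ-≤ T (ballSize-bound R n s) ⟩
  (suc R ^ n * β ^ s) ^ T                             ≡⟨ ^-distribʳ-* (suc R ^ n) (β ^ s) T ⟩
  (suc R ^ n) ^ T * (β ^ s) ^ T                       ≡⟨ cong (_* (β ^ s) ^ T) (^-swap (suc R) n T) ⟩
  (suc R ^ T) ^ n * (β ^ s) ^ T                       ≤⟨ *-mono-≤ (^-monoˡ-≤ n (1+2T^T≤2[2T]^T T)) β-bound ⟩
  (2 * R ^ T) ^ n * 2 ^ n                             ≡⟨ cong (_* 2 ^ n) (^-distribʳ-* 2 (R ^ T) n) ⟩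
  2 ^ n * (R ^ T) ^ n * 2 ^ n                         ≡⟨ swap (2 ^ n) ((R ^ T) ^ n) ⟩
  2 ^ n * 2 ^ n * (R ^ T) ^ n                         ∎)
  where
  open ≤-Reasoning
  R = 2 * T
  β = 2 * suc R
  swap : ∀ x y → x * y * x ≡ x * x * y
  swap = ℕSolver.solve-∀
  rearrange : ∀ β s T → β * s * T ≡ s * (β * T)
  rearrange = ℕSolver.solve-∀
  β-bound : (β ^ s) ^ T ≤ 2 ^ n
  β-bound = begin
    (β ^ s) ^ T           ≤⟨ ^-monoˡ-≤ T (^-monoˡ-≤ s (<⇒≤ (n<2^n β))) ⟩
    ((2 ^ β) ^ s) ^ T     ≡⟨ cong (_^ T) (^-*-assoc 2 β s) ⟩
    (2 ^ (β * s)) ^ T     ≡⟨ ^-*-assoc 2 (β * s) T ⟩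
    2 ^ (β * s * T)       ≤⟨ ^-monoʳ-≤ 2 (subst (_≤ n) (sym (rearrange β s T)) s-small) ⟩
    2 ^ n                 ∎

-- Popular levels and their density

weight : ∀ {N n} → (Fin n → ℕ) → Vec (Fin N) n → ℕ
weight a v = ∑ℕ.sum (λ i → a i * toℕ (Vec.lookup v i))

+-weight : ∀ {N n} (a : Fin n → ℕ) (v : Vec (Fin N) n) → ⟨ a , vecℤ v ⟩ ≡ ℤ.+ weight a v
+-weight a v = sym (trans (+-sum (λ i → a i * toℕ (Vec.lookup v i))) (sumℤ-cong (λ i → ℤ.pos-* (a i) (toℕ (Vec.lookup v i)))))

level : ∀ {N n} → (Fin n → ℕ) → ℕ → List (Vec (Fin N) n)
level {N} {n} a c = filter (λ v → weight a v ≟ c) (allVec N n)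

popular-level : ∀ {N n} → 1 ≤ N → (a : Fin n → ℕ) → ∀ A → (∀ i → a i ≤ A) →
  ∃ λ c → N ^ n ≤ suc (n * (A * N)) * length (level {N} {n} a c)
popular-level {N} {n} N≥1 a A a≤A with Any.any? (λ c → N ^ n ≤? C * length (level {N} {n} a c)) (upTo C)
  where C = suc (n * (A * N))
... | yes found = let c , _ , large = find found in c , large
... | no ¬found = contradiction (begin-strict
  length (concatMap (level a) (upTo C))   ≤⟨ *-cancelˡ-≤ C bounded ⟩
  pred (N ^ n)                            <⟨ ≤-reflexive (suc-pred (N ^ n)) ⟩
  N ^ n                                   ≡⟨ length-allVec N n ⟨
  length (allVec N n)                     ∎)
  (≤⇒≯ (unique-⊆⇒length-≤ (allVec-unique N n) (λ {v} _ → covered v)))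
  where
  open ≤-Reasoning
  C = suc (n * (A * N))
  instance
    N^n≢0 : NonZero (N ^ n)
    N^n≢0 = >-nonZero (m^n>0 N {{>-nonZero N≥1}} n)
  -- If no level is popular, each has C times its length at most N^n - 1. The predecessor keeps the
  -- inequality strict when the C levels are summed.
  bounded : C * length (concatMap (level {N} {n} a) (upTo C)) ≤ C * pred (N ^ n)
  bounded = subst (λ l → C * length (concatMap (level {N} {n} a) (upTo C)) ≤ l * pred (N ^ n)) (length-upTo C)
    (length-concatMap-≤ (level a) C (pred (N ^ n)) (upTo C)
      (λ {c} c∈ → <⇒≤pred (≰⇒> λ large → ¬found (Any.map (λ { refl → large }) c∈))))
  weight<C : ∀ v → weight a v < C
  weight<C v = s≤s (sum-upper _ (A * N) (λ i → *-mono-≤ (a≤A i) (<⇒≤ (Fin.toℕ<n (Vec.lookup v i)))))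
  covered : ∀ v → v ∈ concatMap (level a) (upTo C)
  covered v = ∈-concatMap⁺ (level a) (Any.map (λ { refl → ∈-filter⁺ _ (∈-allVec v) refl }) (∈-upTo⁺ (weight<C v)))

dense-all : ∀ {N n} → 2 ≤ N → ∀ p q → 1 ≤ n → DenseAt N n (allVec N n) (suc p) q
dense-all {N} {n@(suc _)} 2≤N p q _ = begin-strict
  N ^ (n * q)                                    ≡⟨ *-identityʳ _ ⟨
  N ^ (n * q) * 1                                <⟨ *-monoʳ-< (N ^ (n * q)) {{>-nonZero (m^n>0 N (n * q))}} (^-monoʳ-< N 2≤N {0} {n * suc p} (s≤s z≤n)) ⟩
  N ^ (n * q) * N ^ (n * suc p)                  ≡⟨ cong (_* N ^ (n * suc p)) (^-*-assoc N n q) ⟨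
  (N ^ n) ^ q * N ^ (n * suc p)                  ≡⟨ cong (λ l → l ^ q * N ^ (n * suc p)) (length-allVec N n) ⟨
  length (allVec N n) ^ q * N ^ (n * suc p)      ∎
  where
  open ≤-Reasoning
  instance
    N≢0 : NonZero N
    N≢0 = >-nonZero (<-trans z<s 2≤N)

-- Raise N^n ≤ C |S| to the power Q and replace C^Q by the larger N^n: the density exceeds 1 - 1/Q.
-- Strictness needs `S` nonempty, which popularity supplies.
dense-of-popular : ∀ {N n} → 2 ≤ N → ∀ p q C (S : List (Vec (Fin N) n)) →
  N ^ n ≤ C * length S → C ^ suc q < N ^ n → DenseAt N n S (suc p) (suc q)
dense-of-popular {N} {n} 2≤N p q C S popular C-small = begin-strict
  N ^ (n * Q)                              ≡⟨ ^-*-assoc N n Q ⟨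
  (N ^ n) ^ Q                              ≤⟨ ^-monoˡ-≤ Q popular ⟩
  (C * length S) ^ Q                       ≡⟨ ^-distribʳ-* C (length S) Q ⟩
  C ^ Q * length S ^ Q                     <⟨ *-monoˡ-< (length S ^ Q) {{>-nonZero (m^n>0 (length S) {{nonempty}} Q)}} C-small ⟩
  N ^ n * length S ^ Q                     ≡⟨ *-comm (N ^ n) (length S ^ Q) ⟩
  length S ^ Q * N ^ n                     ≤⟨ *-monoʳ-≤ (length S ^ Q) (^-monoʳ-≤ N (m≤m*n n (suc p))) ⟩
  length S ^ Q * N ^ (n * suc p)           ∎
  where
  open ≤-Reasoning
  Q = suc q
  instance
    N≢0 : NonZero N
    N≢0 = >-nonZero (<-trans z<s 2≤N)
  nonempty : NonZero (length S)
  nonempty = ≢-nonZero λ empty → <⇒≱ (m^n>0 N n) (begin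
    N ^ n           ≤⟨ popular ⟩
    C * length S    ≡⟨ cong (C *_) empty ⟩
    C * 0           ≡⟨ *-zeroʳ C ⟩
    0               ∎)

-- Since s ≤ n, the number C of levels is at most N (n+1)² times the ball size, and its 4Q-th power
-- is at most (2^n)^3. If C^Q reached N^n ≥ 2^n, that power would be at least (2^n)^4.
level-count-small : ∀ N Q .{{_ : NonZero Q}} n → 2 ≤ N → let T = Q * 4 ; W = 3 * T in ∀ s →
  N * (W * W) * W ≤ n → s * period T ≤ n →
  suc (n * (s * ballSize n s * N)) ^ Q < N ^ n
level-count-small N Q@(suc _) n 2≤N s n-large s-small = ≰⇒> λ N^n≤ → <⇒≱ 2^3n<2^4n (begin
  (2 ^ n) ^ 4                           ≤⟨ ^-monoˡ-≤ 4 (≤-trans (^-monoˡ-≤ n 2≤N) N^n≤) ⟩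
  (C ^ Q) ^ 4                           ≡⟨ ^-*-assoc C Q 4 ⟩
  C ^ T                                 ≤⟨ ^-monoˡ-≤ T C≤ ⟩
  (N * (suc n * suc n) * f) ^ T         ≡⟨ ^-distribʳ-* (N * (suc n * suc n)) f T ⟩
  (N * (suc n * suc n)) ^ T * f ^ T     ≤⟨ *-mono-≤ (polynomial≤exponential N T n n-large) (ballSize-power T n s s-small) ⟩
  2 ^ n * (2 ^ n * 2 ^ n)               ≡⟨ cong (λ t → 2 ^ n * (2 ^ n * t)) (*-identityʳ (2 ^ n)) ⟨
  (2 ^ n) ^ 3                           ∎)
  where
  open ≤-Reasoning
  T = Q * 4
  W = 3 * T
  f = ballSize n s
  C = suc (n * (s * f * N))
  instance
    N≢0 : NonZero N
    N≢0 = >-nonZero (<-trans z<s 2≤N)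
    f≢0 : NonZero f
    f≢0 = >-nonZero (ballSize≥1 n s)
    n≢0 : NonZero n
    n≢0 = >-nonZero (≤-trans (>-nonZero⁻¹ (N * (W * W) * W) {{m*n≢0 (N * (W * W)) W {{m*n≢0 N (W * W)}}}}) n-large)
  s≤n : s ≤ n
  s≤n = ≤-trans (m≤m*n s (period T)) s-small
  C≤ : C ≤ N * (suc n * suc n) * f
  C≤ = begin
    1 + n * (s * f * N)              ≤⟨ +-mono-≤ (*-mono-≤ (>-nonZero⁻¹ N) (>-nonZero⁻¹ f)) (*-monoʳ-≤ n (*-monoˡ-≤ N (*-monoˡ-≤ f s≤n))) ⟩
    N * f + n * (n * f * N)          ≤⟨ m≤m+n _ (2 * n * N * f) ⟩
    N * f + n * (n * f * N) + 2 * n * N * f ≡⟨ square n N f ⟩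
    N * (suc n * suc n) * f          ∎
    where
    square : ∀ n N f → N * f + n * (n * f * N) + 2 * n * N * f ≡ N * (suc n * suc n) * f
    square = ℕSolver.solve-∀
  2^3n<2^4n : (2 ^ n) ^ 3 < (2 ^ n) ^ 4
  2^3n<2^4n = ^-monoʳ-< (2 ^ n) (^-monoʳ-< 2 (s≤s (s≤s z≤n)) {0} {n} (>-nonZero⁻¹ n)) {3} {4} ≤-refl

-- Dense families with bounded cubes

sparse-family : ∀ {N} → 2 ≤ N → ∀ p q →
  ∃ λ K → (n : ℕ) → Σ (List (Vec (Fin N) n)) λ S →
    Unique S × ((m : ℕ) → HasCube S m → m ≤ K) × (1 ≤ n → DenseAt N n S (suc p) (suc q))
sparse-family {N} 2≤N p q = n₀ * N + D * N , member
  where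
  Q T W n₀ D : ℕ
  Q = suc q
  T = Q * 4
  W = 3 * T
  n₀ = N * (W * W) * W
  D = period T
  member : ∀ n → Σ (List (Vec (Fin N) n)) λ S →
    Unique S × (∀ m → HasCube S m → m ≤ n₀ * N + D * N) × (1 ≤ n → DenseAt N n S (suc p) (suc q))
  member n with n₀ ≤? n
  ... | no n₀≰n = allVec N n , allVec-unique N n , small , dense-all 2≤N p (suc q)
    where
    small : ∀ m → HasCube (allVec N n) m → m ≤ n₀ * N + D * N
    small m hasCube = begin
      m                  ≡⟨ *-identityʳ m ⟨
      -- For the zero functional the whole grid is one level, and radius 0 admits only b = 0, so
      -- `cube-bound` yields m ≤ n N.
      m * 1              ≤⟨ cube-bound (allVec N n) (λ _ → 0) (ℤ.+ 0) {0} (λ {v} _ → sumℤ-0* n (vecℤ v)) zero-dissociated hasCube ⟩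
      n * N              ≤⟨ *-monoˡ-≤ N (<⇒≤ (≰⇒> n₀≰n)) ⟩
      n₀ * N             ≤⟨ m≤m+n _ _ ⟩
      n₀ * N + D * N     ∎
      where
      open ≤-Reasoning
      zero-dissociated : Dissociated {n} (λ _ → 0) 0
      zero-dissociated b ‖b‖≤0 _ i = ℤ.∣i∣≡0⇒i≡0 (n≤0⇒n≡0 (≤-trans (entry≤norm b i) ‖b‖≤0))
        where
        entry≤norm : ∀ {n} (b : Fin n → ℤ.ℤ) i → ℤ.∣ b i ∣ ≤ ‖ b ‖
        entry≤norm b Fin.zero    = m≤m+n _ _
        entry≤norm b (Fin.suc i) = m≤n⇒m≤o+n ℤ.∣ b Fin.zero ∣ (entry≤norm (b ∘ Fin.suc) i)
  ... | yes n₀≤n = level a c , filter⁺ _ (allVec-unique N n) , bound ,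
    λ _ → dense-of-popular 2≤N p q (suc (n * (s * ballSize n s * N))) (level a c) popular
      (level-count-small N Q n 2≤N s n₀≤n (m/n*n≤m n D))
    where
    -- The largest radius with s D ≤ n. Conversely n ≤ (s + 1) D, so the factor s + 1 cancels from m
    -- (s + 1) ≤ n N and leaves a bound independent of n.
    s = n / D
    dissociated = dissociated-exists n s
    a = proj₁ dissociated
    level-found = popular-level {N} {n} (<⇒≤ 2≤N) a (s * ballSize n s) (proj₁ (proj₂ dissociated))
    c = proj₁ level-found
    popular = proj₂ level-found
    bound : ∀ m → HasCube (level {N} {n} a c) m → m ≤ n₀ * N + D * N
    bound m hasCube = ≤-trans (*-cancelʳ-≤ m (D * N) (suc s) (begin
      m * suc s          ≤⟨ cube-bound (level {N} {n} a c) a (ℤ.+ c)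
                              (λ {v} v∈ → trans (+-weight a v) (cong ℤ.+_ (proj₂ (∈-filter⁻ (λ v → weight a v ≟ c) {xs = allVec N n} v∈))))
                              (proj₂ (proj₂ dissociated)) hasCube ⟩
      n * N              ≤⟨ *-monoˡ-≤ N n≤ ⟩
      suc s * D * N      ≡⟨ rearrange (suc s) D N ⟩
      D * N * suc s      ∎)) (m≤n+m (D * N) (n₀ * N))
      where
      open ≤-Reasoning
      rearrange : ∀ x y z → x * y * z ≡ y * z * x
      rearrange = ℕSolver.solve-∀
      n≤ : n ≤ suc s * D
      n≤ = begin
        n                  ≡⟨ m≡m%n+[m/n]*n n D ⟩
        n % D + s * D      ≤⟨ +-monoˡ-≤ (s * D) (<⇒≤ (m%n<n n D)) ⟩
        D + s * D          ∎

theorem1p9 : (N : ℕ) → 2 ≤ N →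
    (((S : (n : ℕ) → List (Vec (Fin N) n)) → ((n : ℕ) → Unique (S n)) →
    ((p q : ℕ) → (n₀ : ℕ) → Σ ℕ λ n → (n₀ ≤ n) × DenseAt N n (S n) (suc p) (suc q)) →
    (K : ℕ) → (n₀ : ℕ) → Σ ℕ λ n → (n₀ ≤ n) × HasCube (S n) K)
    ×
    ((p q : ℕ) →
    Σ ((n : ℕ) → List (Vec (Fin N) n)) λ S →
    ((n : ℕ) → Unique (S n)) ×
    (Σ ℕ λ K → (n : ℕ) → (m : ℕ) → HasCube (S n) m → m ≤ K) ×
    ((n : ℕ) → 1 ≤ n → DenseAt N n (S n) (suc p) (suc q))))
theorem1p9 N 2≤N = dense⇒HasCube 2≤N , λ p q →
  let K , family = sparse-family 2≤N p q
  in proj₁ ∘ family , proj₁ ∘ proj₂ ∘ family ,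
     (K , proj₁ ∘ proj₂ ∘ proj₂ ∘ family) , proj₂ ∘ proj₂ ∘ proj₂ ∘ family
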